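{- Let $d\geq 1$ and let $\lambda=(\lambda_1,\dots,\lambda_d)$ be a partition of length at most $d$ (i.e. integers $\lambda_1\geq\lambda_2\geq\dots\geq\lambda_d\geq 0$). Then the factorial Grothendieck polynomial $G_\lambda(x|b)$ satisfies \[ G_{\lambda}(x|b) = \det\left(\sum_{s\geq 0} \binom{i-d}{s} \beta^s\,G_{\lambda_i+j-i+s}^{(\lambda_i+d-i)}(x|b)\right)_{1\leq i,j\leq d} = \det\left(\sum_{s\geq 0} \binom{i-j}{s} \beta^s\,G_{\lambda_i+j-i+s}^{(\lambda_i+d-i)}(x|b)\right)_{1\leq i,j\leq d}. \] In particular, for every integer $k\geq 0$, $G_{(k,0,\dots,0)}(x|b) = G_k^{(k+d-1)}(x|b)$.
   Context: Let $x=(x_1,\dots,x_d)$ and $b=(b_1,b_2,\dots)$ be sets of indeterminates and $\beta$ a further formal variable (of degree $-1$); all expressions live in the ring $\mathbb{Z}[\beta,b_1,b_2,\dots][[x_1,\dots,x_d]]$. For variables $x,y$ set $x\oplus y:=x+y+\beta xy$ and $[y|b]^k:=(y\oplus b_1)(y\oplus b_2)\cdots(y\oplus b_k)$ for $k\geq 0$. For a partition $\lambda$ of length at most $d$, the factorial Grothendieck polynomial is \[ G_{\lambda}(x|b) =\frac{\det\left([x_j|b]^{\lambda_i+d-i}(1+\beta x_j)^{i-1}\right)_{1\leq i,j\leq d}}{\prod_{1\leq i<j\leq d}(x_i-x_j)} \] (this bi-alternant expression agrees with McNamara's definition via set-valued tableaux). For each integer $k\geq 0$ define $G_m^{(k)}(x|b)$,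 $m\in\mathbb{Z}$, by the generating function \[ \sum_{m\in\mathbb{Z}} G_m^{(k)}(x|b)\,u^m := \frac{1}{1+\beta u^{ -1}}\prod_{i=1}^d\frac{1+\beta x_i}{1- x_i u} \prod_{j=1}^{k} \bigl(1+ (u+\beta)b_j\bigr), \] where $\frac{1}{1+\beta u^{ -1}}$ is expanded as $\sum_{s\geq 0}(-1)^s\beta^s u^{ -s}$ and $\frac{1}{1-x_iu}=\sum_{n\ge0}x_i^nu^n$. The binomial coefficients are generalized: for $n\in\mathbb{Z}$, $\binom{n}{i}$ is defined by $(1+x)^n=\sum_{i\geq0}\binom{n}{i}x^i$, with $\binom{n}{ -i}=0$ for integers $i>0$. -}

module Defs where

open import Algebra.Bundles using (CommutativeRing)
open import Algebra.Structures using (IsCommutativeRing)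
import Algebra.Definitions.RawMonoid as RawMonoidDefs
import Algebra.Properties.CommutativeSemigroup as CommutativeSemigroupProperties
import Algebra.Properties.Ring as RingProperties
import Algebra.Properties.Semiring.Exp as Exp
import Algebra.Properties.Semiring.Sum as Sum
open import Data.Fin.Base as Fin using (Fin; zero; suc; toℕ; inject; punchIn)
open import Data.Fin.Properties using (toℕ<n)
open import Data.Integer.Base as ℤ using (ℤ; +_; -[1+_]; ∣_∣)
import Data.Integer.Properties as ℤ
open import Data.Nat.Base as ℕ using (ℕ; zero; suc; _∸_; _≤_; _<_; z≤n; s≤s)
import Data.Nat.Properties as ℕ
open import Data.Product.Base using (_,_)
open import Data.Vec.Base as Vec using (Vec; []; _∷_)
open import Level using (Level; 0ℓ; _⊔_)
open import Relation.Binary.PropositionalEquality.Core as ≡ using (_≡_)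
import Relation.Binary.Reasoning.Setoid as SetoidReasoning

private
  variable
    c ℓ : Level

------------------------------------------------------------------------
-- Notation in a commutative ring

module RingNotation (R : CommutativeRing c ℓ) where
  open CommutativeRing R public hiding (zero)
  open Exp semiring public using (_^_)
  open Sum semiring public using (sum)
  open RawMonoidDefs *-rawMonoid public using () renaming (sum to product)
  open RawMonoidDefs +-rawMonoid public using (_×_)

  infixr 8 _⋆_

  _⋆_ : ℤ → Carrier → Carrier
  (+ n)    ⋆ a = n × a
  -[1+ n ] ⋆ a = - (suc n × a)

  -- Laplace expansion along the first row; M i j is the entry in row i
  -- and column j.
  det : ∀ {n} → (Fin n → Fin n → Carrier) → Carrier
  det {zero}  M = 1#
  det {suc n} M =
    sum λ j → (- 1#) ^ toℕ j * (M zero j * det λ i k → M (suc i) (punchIn j k))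

------------------------------------------------------------------------
-- The polynomial ring ℤ[X], presented as the free commutative ring on
-- the set X: formal polynomial expressions modulo the least congruence
-- containing the laws of a commutative ring.

module _ {X : Set} where

  infixl 6 _⊞_
  infixl 7 _⊠_
  infix  4 _∼_

  data Expr : Set where
    gen     : X → Expr
    𝟘 𝟙     : Expr
    ⊟_      : Expr → Expr
    _⊞_ _⊠_ : Expr → Expr → Expr

  data _∼_ : Expr → Expr → Set where
    ∼-refl    : ∀ {p} → p ∼ p
    ∼-sym     : ∀ {p q} → p ∼ q → q ∼ p
    ∼-trans   : ∀ {p q r} → p ∼ q → q ∼ r → p ∼ r
    ⊞-cong    : ∀ {p p′ q q′} → p ∼ p′ → q ∼ q′ → p ⊞ q ∼ p′ ⊞ q′
    ⊠-cong    : ∀ {p p′ q q′} → p ∼ p′ → q ∼ q′ → p ⊠ q ∼ p′ ⊠ q′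
    ⊟-cong    : ∀ {p p′} → p ∼ p′ → ⊟ p ∼ ⊟ p′
    ⊞-assoc   : ∀ p q r → (p ⊞ q) ⊞ r ∼ p ⊞ (q ⊞ r)
    ⊞-comm    : ∀ p q → p ⊞ q ∼ q ⊞ p
    ⊞-idˡ     : ∀ p → 𝟘 ⊞ p ∼ p
    ⊟-invˡ    : ∀ p → ⊟ p ⊞ p ∼ 𝟘
    ⊠-assoc   : ∀ p q r → (p ⊠ q) ⊠ r ∼ p ⊠ (q ⊠ r)
    ⊠-comm    : ∀ p q → p ⊠ q ∼ q ⊠ p
    ⊠-idˡ     : ∀ p → 𝟙 ⊠ p ∼ p
    ⊠-distribˡ : ∀ p q r → p ⊠ (q ⊞ r) ∼ p ⊠ q ⊞ p ⊠ r

ℤ[_] : Set → CommutativeRing 0ℓ 0ℓ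
ℤ[ X ] = record
  { Carrier = Expr {X}
  ; _≈_ = _∼_
  ; _+_ = _⊞_
  ; _*_ = _⊠_
  ; -_  = ⊟_
  ; 0#  = 𝟘
  ; 1#  = 𝟙
  ; isCommutativeRing = record
    { isRing = record
      { +-isAbelianGroup = record
        { isGroup = record
          { isMonoid = record
            { isSemigroup = record
              { isMagma = record
                { isEquivalence = record
                  { refl = ∼-refl ; sym = ∼-sym ; trans = ∼-trans }
                ; ∙-cong = ⊞-cong
                }
              ; assoc = ⊞-assoc
              }
            ; identity = ⊞-idˡ , λ p → ∼-trans (⊞-comm p 𝟘) (⊞-idˡ p)
            }
          ; inverse = ⊟-invˡ , λ p → ∼-trans (⊞-comm p (⊟ p)) (⊟-invˡ p)
          ; ⁻¹-cong = ⊟-cong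
          }
        ; comm = ⊞-comm
        }
      ; *-cong = ⊠-cong
      ; *-assoc = ⊠-assoc
      ; *-identity = ⊠-idˡ , λ p → ∼-trans (⊠-comm p 𝟙) (⊠-idˡ p)
      ; distrib = ⊠-distribˡ
                , λ p q r → ∼-trans (⊠-comm (q ⊞ r) p)
                    (∼-trans (⊠-distribˡ p q r)
                      (⊞-cong (⊠-comm p q) (⊠-comm p r)))
      }
    ; *-comm = ⊠-comm
    }
  }

------------------------------------------------------------------------
-- Formal power series in one variable

module PowerSeries (R : CommutativeRing c ℓ) where
  open RingNotation R
  open SetoidReasoning setoid
  private
    module Σ = Sum semiring
    module +-Props = CommutativeSemigroupProperties +-commutativeSemigroup

  Series : Set c
  Series = ℕ → Carrier

  infix  4 _≋_
  infixl 6 _⊕_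
  infixl 7 _⊛_

  _≋_ : Series → Series → Set ℓ
  f ≋ g = ∀ n → f n ≈ g n

  _⊕_ : Series → Series → Series
  (f ⊕ g) n = f n + g n

  _⊛_ : Series → Series → Series
  (f ⊛ g) n = sum {suc n} λ i → f (toℕ i) * g (n ∸ toℕ i)

  ⊖_ : Series → Series
  (⊖ f) n = - f n

  C : Carrier → Series
  C a zero    = a
  C a (suc _) = 0#

  X : Series
  X 0             = 0#
  X 1             = 1#
  X (suc (suc _)) = 0#

  -- The expansion of 1 / (1 - a X).
  geometric : Carrier → Series
  geometric a n = a ^ n

  private
    tail : Series → Series
    tail f n = f (suc n)

    scale : Carrier → Series → Series
    scale a f n = a * f n

  ⊛-cong : ∀ {f f′ g g′} → f ≋ f′ → g ≋ g′ → f ⊛ g ≋ f′ ⊛ g′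
  ⊛-cong p q n = Σ.sum-cong-≋ {suc n} λ i → *-cong (p (toℕ i)) (q (n ∸ toℕ i))

  ⊛-distribʳ : ∀ h f g → (f ⊕ g) ⊛ h ≋ f ⊛ h ⊕ g ⊛ h
  ⊛-distribʳ h f g n = trans
    (Σ.sum-cong-≋ {suc n} λ i → distribʳ (h (n ∸ toℕ i)) (f (toℕ i)) (g (toℕ i)))
    (Σ.∑-distrib-+ {suc n} (λ i → f (toℕ i) * h (n ∸ toℕ i))
                           (λ i → g (toℕ i) * h (n ∸ toℕ i)))

  ⊛-comm : ∀ f g → f ⊛ g ≋ g ⊛ f
  ⊛-comm f g 0 = +-congʳ (*-comm (f 0) (g 0))
  ⊛-comm f g 1 = begin
    f 0 * g 1 + (f 1 * g 0 + 0#)  ≈⟨ +-Props.x∙yz≈y∙xz _ _ _ ⟩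
    f 1 * g 0 + (f 0 * g 1 + 0#)  ≈⟨ +-cong (*-comm _ _) (+-congʳ (*-comm _ _)) ⟩
    g 0 * f 1 + (g 1 * f 0 + 0#)  ∎
  ⊛-comm f g (suc (suc n)) = begin
    f 0 * g (2 ℕ.+ n) + (tail f ⊛ g) (suc n)
      ≈⟨ +-congˡ (⊛-comm (tail f) g (suc n)) ⟩
    f 0 * g (2 ℕ.+ n) + (g 0 * f (2 ℕ.+ n) + (tail g ⊛ tail f) n)
      ≈⟨ +-Props.x∙yz≈y∙xz _ _ _ ⟩
    g 0 * f (2 ℕ.+ n) + (f 0 * g (2 ℕ.+ n) + (tail g ⊛ tail f) n)
      ≈⟨ +-congˡ (+-congˡ (⊛-comm (tail g) (tail f) n)) ⟩
    g 0 * f (2 ℕ.+ n) + (f ⊛ tail g) (suc n)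
      ≈⟨ +-congˡ (⊛-comm f (tail g) (suc n)) ⟩
    g 0 * f (2 ℕ.+ n) + (tail g ⊛ f) (suc n) ∎

  private
    scale-⊛ : ∀ a f g → scale a f ⊛ g ≋ scale a (f ⊛ g)
    scale-⊛ a f g n = trans
      (Σ.sum-cong-≋ {suc n} λ i → *-assoc a (f (toℕ i)) (g (n ∸ toℕ i)))
      (sym (Σ.*-distribˡ-sum {suc n} a λ i → f (toℕ i) * g (n ∸ toℕ i)))

  ⊛-assoc : ∀ f g h → (f ⊛ g) ⊛ h ≋ f ⊛ (g ⊛ h)
  ⊛-assoc f g h zero = +-congʳ (begin
    (f 0 * g 0 + 0#) * h 0  ≈⟨ *-congʳ (+-identityʳ _) ⟩
    f 0 * g 0 * h 0         ≈⟨ *-assoc _ _ _ ⟩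
    f 0 * (g 0 * h 0)       ≈⟨ *-congˡ (+-identityʳ _) ⟨
    f 0 * (g 0 * h 0 + 0#)  ∎)
  ⊛-assoc f g h (suc n) = begin
    (f 0 * g 0 + 0#) * h (suc n) + ((scale (f 0) (tail g) ⊕ tail f ⊛ g) ⊛ h) n
      ≈⟨ +-cong (trans (*-congʳ (+-identityʳ _)) (*-assoc _ _ _))
           (trans (⊛-distribʳ h (scale (f 0) (tail g)) (tail f ⊛ g) n)
             (+-cong (scale-⊛ (f 0) (tail g) h n) (⊛-assoc (tail f) g h n))) ⟩
    f 0 * (g 0 * h (suc n)) + (f 0 * (tail g ⊛ h) n + (tail f ⊛ (g ⊛ h)) n)
      ≈⟨ +-assoc _ _ _ ⟨
    f 0 * (g 0 * h (suc n)) + f 0 * (tail g ⊛ h) n + (tail f ⊛ (g ⊛ h)) n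
      ≈⟨ +-congʳ (distribˡ _ _ _) ⟨
    f 0 * (g ⊛ h) (suc n) + (tail f ⊛ (g ⊛ h)) n ∎

  ⊛-identityˡ : ∀ f → C 1# ⊛ f ≋ f
  ⊛-identityˡ f n = begin
    1# * f n + sum {n} (λ i → 0# * f (n ∸ suc (toℕ i)))
      ≈⟨ +-cong (*-identityˡ _) (Σ.sum-cong-≋ {n} λ i → zeroˡ _) ⟩
    f n + sum {n} (λ _ → 0#)
      ≈⟨ +-congˡ (Σ.sum-replicate-zero n) ⟩
    f n + 0#
      ≈⟨ +-identityʳ _ ⟩
    f n ∎

  isCommutativeRing-⟦X⟧ : IsCommutativeRing _≋_ _⊕_ _⊛_ ⊖_ (λ _ → 0#) (C 1#)
  isCommutativeRing-⟦X⟧ = record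
    { isRing = record
      { +-isAbelianGroup = record
        { isGroup = record
          { isMonoid = record
            { isSemigroup = record
              { isMagma = record
                { isEquivalence = record
                  { refl  = λ _ → refl
                  ; sym   = λ p n → sym (p n)
                  ; trans = λ p q n → trans (p n) (q n)
                  }
                ; ∙-cong = λ p q n → +-cong (p n) (q n)
                }
              ; assoc = λ f g h n → +-assoc (f n) (g n) (h n)
              }
            ; identity = (λ f n → +-identityˡ (f n)) , (λ f n → +-identityʳ (f n))
            }
          ; inverse = (λ f n → -‿inverseˡ (f n)) , (λ f n → -‿inverseʳ (f n))
          ; ⁻¹-cong = λ p n → -‿cong (p n)
          }
        ; comm = λ f g n → +-comm (f n) (g n)
        }
      ; *-cong = λ {f} {f′} {g} {g′} → ⊛-cong {f} {f′} {g} {g′}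
      ; *-assoc = ⊛-assoc
      ; *-identity = ⊛-identityˡ
                   , λ f n → trans (⊛-comm f (C 1#) n) (⊛-identityˡ f n)
      ; distrib = (λ f g h n → begin
                    (f ⊛ (g ⊕ h)) n          ≈⟨ ⊛-comm f (g ⊕ h) n ⟩
                    ((g ⊕ h) ⊛ f) n          ≈⟨ ⊛-distribʳ f g h n ⟩
                    (g ⊛ f) n + (h ⊛ f) n    ≈⟨ +-cong (⊛-comm g f n) (⊛-comm h f n) ⟩
                    (f ⊛ g) n + (f ⊛ h) n    ∎)
                , ⊛-distribʳ
      }
    ; *-comm = ⊛-comm
    }

infix 9 _⟦X⟧

_⟦X⟧ : CommutativeRing c ℓ → CommutativeRing c ℓ
R ⟦X⟧ = record { isCommutativeRing = PowerSeries.isCommutativeRing-⟦X⟧ R }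

------------------------------------------------------------------------
-- Binomial coefficients with arbitrary integer upper index, read off
-- from (1 + X)ⁿ in ℤ⟦X⟧, where (1 + X)⁻¹ = 1 / (1 - (- 1) X).

module _ where
  open RingNotation (ℤ.+-*-commutativeRing ⟦X⟧)
  open PowerSeries ℤ.+-*-commutativeRing using (X; geometric)

  [1+X]^_ : ℤ → Carrier
  [1+X]^ (+ n)    = (1# + X) ^ n
  [1+X]^ -[1+ n ] = geometric ℤ.-1ℤ ^ suc n

  binomial : ℤ → ℕ → ℤ
  binomial n i = ([1+X]^ n) i

------------------------------------------------------------------------
-- Formal power series in d variables: R⟦x₁,…,x_d⟧ is R⟦x₂,…,x_d⟧⟦x₁⟧.

module MultiSeries (R : CommutativeRing c ℓ) where
  private
    module R = RingNotation R

  R⟦x⟧ : ℕ → CommutativeRing c ℓ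
  R⟦x⟧ zero    = R
  R⟦x⟧ (suc d) = R⟦x⟧ d ⟦X⟧

  private
    module S (d : ℕ) = RingNotation (R⟦x⟧ d)

  const : ∀ d → R.Carrier → S.Carrier d
  const zero    r = r
  const (suc d) r = PowerSeries.C (R⟦x⟧ d) (const d r)

  var : ∀ d → Fin d → S.Carrier d
  var (suc d) zero    = PowerSeries.X (R⟦x⟧ d)
  var (suc d) (suc i) = PowerSeries.C (R⟦x⟧ d) (var d i)

  -- The coefficient of the monomial with exponent vector μ.
  coeff : ∀ d → S.Carrier d → Vec ℕ d → R.Carrier
  coeff zero    f []      = f
  coeff (suc d) f (m ∷ μ) = coeff d (f m) μ

  fromCoeff : ∀ d → (Vec ℕ d → R.Carrier) → S.Carrier d
  fromCoeff zero    a   = a []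
  fromCoeff (suc d) a m = fromCoeff d λ μ → a (m ∷ μ)

  -- Infinite sums, for sequences in which every monomial occurs only
  -- finitely often.  Up to _≈_ the sum does not depend on the bounds.

  record Summable (d : ℕ) (a : ℕ → S.Carrier d) : Set (c ⊔ ℓ) where
    field
      bound    : Vec ℕ d → ℕ
      vanishes : ∀ μ s → bound μ ≤ s → coeff d (a s) μ R.≈ R.0#

  ∑∞ : ∀ d (a : ℕ → S.Carrier d) → Summable d a → S.Carrier d
  ∑∞ d a a-summable =
    fromCoeff d λ μ → R.sum {bound μ} λ s → coeff d (a (toℕ s)) μ
    where open Summable a-summable

  -- Order d n f: all monomials of f have total degree at least n.

  Order : ∀ d → ℕ → S.Carrier d → Set ℓ
  Order zero    n f = 0 < n → f R.≈ R.0#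
  Order (suc d) n f = ∀ i → Order d (n ∸ i) (f i)

  order-coeff : ∀ d {n f} → Order d n f →
                ∀ μ → Vec.sum μ < n → coeff d f μ R.≈ R.0#
  order-coeff zero    o []      0<n = o 0<n
  order-coeff (suc d) {n} o (m ∷ μ) lt =
    order-coeff d (o m) μ
      (ℕ.m+n≤o⇒m≤o∸n (suc (Vec.sum μ))
        (≡.subst (_< n) (ℕ.+-comm m (Vec.sum μ)) lt))

  order-fromCoeff : ∀ d {n} a → (∀ μ → Vec.sum μ < n → a μ R.≈ R.0#) →
                    Order d n (fromCoeff d a)
  order-fromCoeff zero    a v 0<n = v [] 0<n
  order-fromCoeff (suc d) {n} a v m =
    order-fromCoeff d (λ μ → a (m ∷ μ)) λ μ lt →
      v (m ∷ μ) (≡.subst (_≤ n) (ℕ.+-suc m (Vec.sum μ))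
        (≡.subst (_≤ n) (ℕ.+-comm (suc (Vec.sum μ)) m)
          (ℕ.≤-trans (ℕ.+-monoˡ-≤ m lt)
            (ℕ.≤-reflexive (ℕ.m∸n+n≡m (m≤n m lt))))))
    where
    m≤n : ∀ {k} m → k < n ∸ m → m ≤ n
    m≤n {k} m lt = ℕ.<⇒≤ (ℕ.m∸n≢0⇒n<m λ eq → ℕ.n≮0 (≡.subst (k <_) eq lt))

  order-mono : ∀ d {m n f} → m ≤ n → Order d n f → Order d m f
  order-mono zero    m≤n o 0<m = o (ℕ.≤-trans 0<m m≤n)
  order-mono (suc d) m≤n o i   = order-mono d (ℕ.∸-monoˡ-≤ i m≤n) (o i)

  order-any : ∀ d f → Order d 0 f
  order-any zero    f ()
  order-any (suc d) f i = order-mono d (ℕ.≤-reflexive (ℕ.0∸n≡0 i)) (order-any d (f i))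

  order-0 : ∀ d n → Order d n (S.0# d)
  order-0 zero    n _ = R.refl
  order-0 (suc d) n i = order-0 d (n ∸ i)

  order-+ : ∀ d {n f g} → Order d n f → Order d n g → Order d n (S._+_ d f g)
  order-+ zero    o p 0<n = R.trans (R.+-cong (o 0<n) (p 0<n)) (R.+-identityˡ R.0#)
  order-+ (suc d) o p i   = order-+ d (o i) (p i)

  order-sum : ∀ d {n} k (t : Fin k → S.Carrier d) → (∀ i → Order d n (t i)) →
              Order d n (S.sum d t)
  order-sum d zero    t o = order-0 d _
  order-sum d (suc k) t o = order-+ d (o zero) (order-sum d k (λ i → t (suc i)) λ i → o (suc i))

  private
    m+n∸i≤ : ∀ p q j k i → j ℕ.+ k ≡ i → (p ℕ.+ q) ∸ i ≤ (p ∸ j) ℕ.+ (q ∸ k)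
    m+n∸i≤ p q j k _ ≡.refl = ℕ.m≤n+o⇒m∸n≤o (p ℕ.+ q) (j ℕ.+ k)
      (ℕ.≤-trans (ℕ.+-mono-≤ (ℕ.m≤n+m∸n p j) (ℕ.m≤n+m∸n q k))
        (ℕ.≤-reflexive (interchange j (p ∸ j) k (q ∸ k))))
      where open CommutativeSemigroupProperties ℕ.+-commutativeSemigroup

    i∸k+j∸l≥ : ∀ n j k l → j ≤ n → n ∸ (k ℕ.+ l) ≤ (j ∸ k) ℕ.+ ((n ∸ j) ∸ l)
    i∸k+j∸l≥ n j k l j≤n = ≡.subst (λ m → m ∸ (k ℕ.+ l) ≤ (j ∸ k) ℕ.+ ((n ∸ j) ∸ l))
      (ℕ.m+[n∸m]≡n j≤n) (m+n∸i≤ j (n ∸ j) k l (k ℕ.+ l) ≡.refl)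

    toℕ≤ : ∀ {n} (i : Fin (suc n)) → toℕ i ≤ n
    toℕ≤ i = ℕ.≤-pred (toℕ<n i)

  order-* : ∀ d p q {f g} → Order d p f → Order d q g →
            Order d (p ℕ.+ q) (S._*_ d f g)
  order-* zero zero    q {f} o o′ 0<q = R.trans (R.*-congˡ (o′ 0<q)) (R.zeroʳ f)
  order-* zero (suc p) q {f} {g} o o′ _ =
    R.trans (R.*-congʳ (o (s≤s z≤n))) (R.zeroˡ g)
  order-* (suc d) p q o o′ i = order-sum d (suc i) _ λ j →
    order-mono d (m+n∸i≤ p q (toℕ j) (i ∸ toℕ j) i (ℕ.m+[n∸m]≡n (toℕ≤ j)))
      (order-* d _ _ (o (toℕ j)) (o′ (i ∸ toℕ j)))

  order-*ˡ : ∀ d {n} f {g} → Order d n g → Order d n (S._*_ d f g)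
  order-*ˡ d f = order-* d 0 _ (order-any d f)

  order-neg : ∀ d {n f} → Order d n f → Order d n (S.-_ d f)
  order-neg zero o 0<n = R.trans (R.-‿cong (o 0<n)) (RingProperties.-0#≈0# R.ring)
  order-neg (suc d) o i = order-neg d (o i)

  order-× : ∀ d {n} k {f} → Order d n f → Order d n (S._×_ d k f)
  order-× d zero    o = order-0 d _
  order-× d (suc k) o = order-+ d o (order-× d k o)

  order-⋆ : ∀ d {n} z {f} → Order d n f → Order d n (S._⋆_ d z f)
  order-⋆ d (+ k)      o = order-× d k o
  order-⋆ d (-[1+ k ]) o = order-neg d (order-× d (suc k) o)

  order-var : ∀ d i → Order d 1 (var d i)
  order-var (suc d) zero    zero    = order-0 d 1
  order-var (suc d) zero    (suc j) =
    order-mono d (ℕ.≤-reflexive (ℕ.0∸n≡0 j)) (order-any d _)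
  order-var (suc d) (suc i) zero    = order-var d i
  order-var (suc d) (suc i) (suc j) = order-0 d _

  order-var^ : ∀ d i n → Order d n (S._^_ d (var d i) n)
  order-var^ d i zero    = order-any d _
  order-var^ d i (suc n) = order-* d 1 n (order-var d i) (order-var^ d i n)

  order-∑∞ : ∀ d {n a} (a-summable : Summable d a) → (∀ s → Order d n (a s)) →
             Order d n (∑∞ d a a-summable)
  order-∑∞ d a-summable o = order-fromCoeff d _ λ μ lt →
    let N = Summable.bound a-summable μ in
    R.trans (Sum.sum-cong-≋ R.semiring {N} λ s → order-coeff d (o (toℕ s)) μ lt)
            (Sum.sum-replicate-zero R.semiring N)

  -- Slope d k A, for A a series in u: the coefficient of uⁿ has order at
  -- least n - k.

  module _ (d : ℕ) where
    private
      module U = RingNotation (R⟦x⟧ d ⟦X⟧)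

    Slope : ℕ → U.Carrier → Set ℓ
    Slope k A = ∀ n → Order d (n ∸ k) (A n)

    slope-C : ∀ k f → Slope k (PowerSeries.C (R⟦x⟧ d) f)
    slope-C k f zero    = order-mono d (ℕ.≤-reflexive (ℕ.0∸n≡0 k)) (order-any d f)
    slope-C k f (suc n) = order-0 d _

    slope-X : Slope 1 (PowerSeries.X (R⟦x⟧ d))
    slope-X 0             = order-any d _
    slope-X 1             = order-any d _
    slope-X (suc (suc n)) = order-0 d _

    slope-+ : ∀ k {A B} → Slope k A → Slope k B → Slope k (A U.+ B)
    slope-+ k a b n = order-+ d (a n) (b n)

    slope-* : ∀ k l {A B} → Slope k A → Slope l B → Slope (k ℕ.+ l) (A U.* B)
    slope-* k l a b n = order-sum d (suc n) _ λ j →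
      order-mono d (i∸k+j∸l≥ n (toℕ j) k l (toℕ≤ j))
        (order-* d _ _ (a (toℕ j)) (b (n ∸ toℕ j)))

    slope-product₀ : ∀ n (t : Fin n → U.Carrier) → (∀ i → Slope 0 (t i)) →
                     Slope 0 (U.product t)
    slope-product₀ zero    t s = slope-C 0 _
    slope-product₀ (suc n) t s =
      slope-* 0 0 (s zero) (slope-product₀ n (λ i → t (suc i)) λ i → s (suc i))

    slope-product₁ : ∀ n (t : Fin n → U.Carrier) → (∀ i → Slope 1 (t i)) →
                     Slope n (U.product t)
    slope-product₁ zero    t s = slope-C 0 _
    slope-product₁ (suc n) t s =
      slope-* 1 n (s zero) (slope-product₁ n (λ i → t (suc i)) λ i → s (suc i))

  private
    abs-shift : ∀ m n s → n ℕ.+ ∣ m ∣ ≤ s → + n ℤ.≤ m ℤ.+ + s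
    abs-shift (+ a)    n s le =
      ℤ.+≤+ (ℕ.≤-trans (ℕ.m≤m+n n a) (ℕ.≤-trans le (ℕ.m≤n+m s a)))
    abs-shift -[1+ a ] n s le = ≡.subst (+ n ℤ.≤_)
      (≡.sym (ℤ.⊖-≥ (ℕ.≤-trans (ℕ.m≤n+m (suc a) n) le)))
      (ℤ.+≤+ (ℕ.m+n≤o⇒m≤o∸n n le))

  summable : ∀ d k m (a : ℕ → S.Carrier d) →
             (∀ n s → + (n ℕ.+ k) ℤ.≤ m ℤ.+ + s → Order d n (a s)) → Summable d a
  summable d k m a o = record
    { bound    = λ μ → suc (Vec.sum μ) ℕ.+ k ℕ.+ ∣ m ∣
    ; vanishes = λ μ s le →
        order-coeff d (o (suc (Vec.sum μ)) s (abs-shift m _ s le)) μ ℕ.≤-refl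
    }

------------------------------------------------------------------------
-- Factorial Grothendieck polynomials

data Indeterminate : Set where
  β : Indeterminate
  b : ℕ → Indeterminate   -- b j stands for b_{j+1}

open MultiSeries ℤ[ Indeterminate ] using (R⟦x⟧)

record Partition (d : ℕ) : Set where
  field
    part       : Fin d → ℕ
    decreasing : ∀ {i j} → i Fin.≤ j → part j ≤ part i

open Partition public using (part)

-- The partition (k, 0, …, 0).
row : ∀ {d} → ℕ → Partition d
row k = record
  { part       = rowPart
  ; decreasing = λ { {zero} {zero} _ → ℕ.≤-refl ; {_} {suc _} _ → z≤n }
  }
  where
  rowPart : ∀ {d} → Fin d → ℕ
  rowPart zero    = k
  rowPart (suc _) = 0

module FactorialGrothendieck (d : ℕ) where

  private
    module S = RingNotation (R⟦x⟧ d)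
    module U = RingNotation (R⟦x⟧ d ⟦X⟧)
  open S
  open S public using (Carrier; _≈_; det)
  open PowerSeries (R⟦x⟧ d) using (C; X; geometric)
  open MultiSeries ℤ[ Indeterminate ]
    hiding (R⟦x⟧)

  x : Fin d → Carrier
  x = var d

  β′ : Carrier
  β′ = const d (gen β)

  b′ : ℕ → Carrier
  b′ j = const d (gen (b j))

  infixl 6 _⊕_

  _⊕_ : Carrier → Carrier → Carrier
  y ⊕ z = y + z + β′ * y * z

  [_∣b]^_ : Carrier → ℕ → Carrier
  [ y ∣b]^ k = product {k} λ j → y ⊕ b′ (toℕ j)

  -- Rows and columns are numbered from 0, so row i here is row i + 1 of
  -- the usual 1-based formulas; in particular d ∸ suc (toℕ i) is the
  -- usual d - i.

  alternant : Partition d → Carrier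
  alternant p = det λ i j →
    [ x j ∣b]^ (part p i ℕ.+ (d ∸ suc (toℕ i))) * (1# + β′ * x j) ^ toℕ i

  vandermonde : Carrier
  vandermonde = product {d} λ j → product {toℕ j} λ i → x (inject {i = j} i) - x j

  -- G = alternant p / vandermonde; the quotient is unique since vandermonde
  -- is a non-zero-divisor in the power series ring.
  IsG : Partition d → Carrier → Set
  IsG p G = vandermonde * G ≈ alternant p

  -- ∏ᵢ (1 + β xᵢ) / (1 - xᵢ u) · ∏_{j ≤ k} (1 + (u + β) bⱼ), as a series in u.
  F : ℕ → U.Carrier
  F k = U.product {d} (λ i → C (1# + β′ * x i) U.* geometric (x i))
        U.* U.product {k} (λ j → U.1# U.+ (X U.+ C β′) U.* C (b′ (toℕ j)))

  F-coeff : ℕ → ℤ → Carrier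
  F-coeff k (+ n)    = F k n
  F-coeff k -[1+ _ ] = 0#

  F-slope : ∀ k → Slope d k (F k)
  F-slope k = slope-* d 0 k
    (slope-product₀ d d _ λ i →
      slope-* d 0 0 (slope-C d 0 (1# + β′ * x i)) (order-var^ d i))
    (slope-product₁ d k _ λ j →
      slope-+ d 1 (slope-C d 1 1#)
        (slope-* d 1 0 (slope-+ d 1 (slope-X d) (slope-C d 1 β′)) (slope-C d 0 (b′ (toℕ j)))))

  F-coeff-order : ∀ k m n → + (n ℕ.+ k) ℤ.≤ m → Order d n (F-coeff k m)
  F-coeff-order k (+ m) n (ℤ.+≤+ le) =
    order-mono d (ℕ.m+n≤o⇒m≤o∸n n le) (F-slope k m)

  -- G_m^{(k)} is the coefficient of u^m in the product of
  -- ∑ₛ (-1)ˢ βˢ u⁻ˢ with F k.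

  Gm-term : ℕ → ℤ → ℕ → Carrier
  Gm-term k m s = (- 1#) ^ s * β′ ^ s * F-coeff k (m ℤ.+ + s)

  Gm-summable : ∀ k m → Summable d (Gm-term k m)
  Gm-summable k m = summable d k m _ λ n s le →
    order-*ˡ d _ (F-coeff-order k (m ℤ.+ + s) n le)

  Gm : ℕ → ℤ → Carrier
  Gm k m = ∑∞ d (Gm-term k m) (Gm-summable k m)

  Gm-order : ∀ k m n → + (n ℕ.+ k) ℤ.≤ m → Order d n (Gm k m)
  Gm-order k m n le = order-∑∞ d (Gm-summable k m) λ s →
    order-*ˡ d _ (F-coeff-order k (m ℤ.+ + s) n
      (ℤ.≤-trans le (ℤ.i≤i+j m (+ s))))

  -- ∑ₛ binomial(e, s) βˢ G_{m+s}^{(k)}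

  entry-term : ℤ → ℕ → ℤ → ℕ → Carrier
  entry-term e k m s = binomial e s ⋆ (β′ ^ s * Gm k (m ℤ.+ + s))

  entry-summable : ∀ e k m → Summable d (entry-term e k m)
  entry-summable e k m = summable d k m _ λ n s le →
    order-⋆ d (binomial e s) (order-*ˡ d _ (Gm-order k (m ℤ.+ + s) n le))

  entry : ℤ → ℕ → ℤ → Carrier
  entry e k m = ∑∞ d (entry-term e k m) (entry-summable e k m)

-- Write S for the shift of the index m.  The entries E^e(m), namely
-- ∑ₛ binomial(e, s) βˢ Gₘ₊ₛ^{(k)}, satisfy (1 + β S) E^e = E^{e+1}, and E^1(m)
-- is the coefficient of uᵐ in F k.  The operator 1 + β S is injective on
-- sequences whose order tends to infinity, so no infinite sum has to be
-- rearranged.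
--
-- Let M be the matrix whose column p holds the coefficients of
-- ∏_{i ≠ p} (X - xᵢ); its determinant is the Vandermonde product.  Applying
-- ∏_{i ≠ p} (S - xᵢ) to the coefficients of F k cancels all factors
-- 1 / (1 - xᵢ u) except the p-th, and what remains is evaluated at u = 1 / xₚ.
-- Hence the first matrix times M is the alternant matrix, up to powers of
-- 1 + β xₚ that cancel.  The second matrix arises from the first by unitriangular
-- column operations.  For a one-row partition it is upper triangular, with
-- diagonal entries below the first equal to G₀^{(k)} = F k at u = -β, which is 1.

module Submission where

open import Defs
open import Algebra.Bundles using (CommutativeRing)
import Algebra.Properties.CommutativeMonoid.Sum as CommutativeMonoidSum
import Algebra.Properties.Ring as RingProperties
import Algebra.Properties.Semiring.Exp as Exp
import Algebra.Properties.Semiring.Mult as Mult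
import Algebra.Properties.Semiring.Sum as Sum
import Algebra.Solver.Ring.NaturalCoefficients.Default as Solver
open import Data.Empty using (⊥-elim)
open import Data.Fin.Base as Fin using (Fin; zero; suc; toℕ; inject; inject₁; punchIn)
import Data.Fin.Properties as Fin
open import Data.Integer.Base as ℤ using (ℤ; +_; -[1+_]; ∣_∣)
import Data.Integer.Properties as ℤ
import Data.Integer.Tactic.RingSolver as ℤ using (solve-∀)
open import Data.Nat.Base as ℕ using (ℕ; zero; suc; _∸_; _≤_; _<_; z≤n; s≤s; NonZero)
import Data.Nat.Properties as ℕ
open import Data.Product.Base as Product using (_,_; ∃-syntax)
open import Data.Sum.Base using (inj₁; inj₂)
open import Data.Vec.Base as Vec using (Vec)
open import Data.Vec.Functional using (_∷_; updateAt)
open import Data.Vec.Functional.Properties using (updateAt-updates; updateAt-minimal)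
open import Function.Base using (_∘_; const)
import Level
open import Relation.Binary.PropositionalEquality as ≡ using (_≡_; _≢_)
import Relation.Binary.Reasoning.Setoid as SetoidReasoning
open import Relation.Nullary using (yes; no)

-- `det` is given only by expansion along the first row, so its multiplicativity is obtained from a
-- uniqueness statement: every alternating multilinear form of the rows is `det` times its value at
-- the identity matrix. No quotient is ever formed. Division by 1 + β xₚ becomes cancellation
-- because β xₚ has positive order in the variables, division by the Vandermonde product because a
-- difference of two distinct variables is a non-zero-divisor. Orders count the degree in x alone; β
-- and the bⱼ have weight 0. The entries still tend to 0 in m because each of the k factors 1 + (u +
-- β) bⱼ can supply only one u without an x. The exponents of the first matrix are calibrated for
-- the cancellation. Row i, counted from 0, has exponent 1 - (d - i), so compared with E^1 its
-- entries in column p of the product lack d - i factors 1 + β xₚ. Scaling that column by (1 + β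
-- xₚ)^d leaves (1 + β xₚ)^i, the factor in the alternant. Every entry also carries ∏ᵢ (1 + β xᵢ)
-- from `F`, and over d columns this balances the scaling.

-- Determinants as alternating multilinear forms of the rows.

module Determinant {c ℓ} (R : CommutativeRing c ℓ) where
  open RingNotation R
  open SetoidReasoning setoid
  open Solver commutativeSemiring using (solve; _:+_; _:*_; _:=_)
  private
    module Σ = Sum semiring

  Matrix : ℕ → ℕ → Set c
  Matrix n m = Fin n → Fin m → Carrier

  infix 4 _≈ₘ_
  _≈ₘ_ : ∀ {n m} → Matrix n m → Matrix n m → Set ℓ
  M ≈ₘ N = ∀ i j → M i j ≈ N i j

  x+-1*x≈0 : ∀ x → x + - 1# * x ≈ 0#
  x+-1*x≈0 x = begin
    x + - 1# * x       ≈⟨ +-congʳ (*-identityˡ x) ⟨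
    1# * x + - 1# * x  ≈⟨ distribʳ x 1# (- 1#) ⟨
    (1# + - 1#) * x    ≈⟨ *-congʳ (-‿inverseʳ 1#) ⟩
    0# * x             ≈⟨ zeroˡ x ⟩
    0#                 ∎

  x+y≈0⇒y≈-1*x : ∀ {x y} → x + y ≈ 0# → y ≈ - 1# * x
  x+y≈0⇒y≈-1*x {x} {y} eq = begin
    y                       ≈⟨ +-identityˡ y ⟨
    0# + y                  ≈⟨ +-congʳ (x+-1*x≈0 x) ⟨
    (x + - 1# * x) + y      ≈⟨ solve 3 (λ x m y → (x :+ m) :+ y := (x :+ y) :+ m) refl x (- 1# * x) y ⟩
    (x + y) + - 1# * x      ≈⟨ +-congʳ eq ⟩
    0# + - 1# * x           ≈⟨ +-identityˡ _ ⟩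
    - 1# * x                ∎

  sum-linear : ∀ {n} a a′ (f g : Fin n → Carrier) →
               sum (λ j → a * f j + a′ * g j) ≈ a * sum f + a′ * sum g
  sum-linear a a′ f g = trans (Σ.∑-distrib-+ (λ j → a * f j) (λ j → a′ * g j))
    (+-cong (sym (Σ.*-distribˡ-sum a f)) (sym (Σ.*-distribˡ-sum a′ g)))

  sum-zero : ∀ {n} (f : Fin n → Carrier) → (∀ i → f i ≈ 0#) → sum f ≈ 0#
  sum-zero {n} f eq = trans (Σ.sum-cong-≋ {n} eq) (Σ.sum-replicate-zero n)

  -- The matrices need not be square: the inductions freeze the first row of `D`, which leaves a
  -- form with fewer rows than columns.
  record Multilinear {n m} (D : Matrix n m → Carrier) : Set (c Level.⊔ ℓ) where
    field
      D-cong : ∀ {M N} → M ≈ₘ N → D M ≈ D N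
      linear : ∀ p a a′ {L M N} →
               (∀ k → L p k ≈ a * M p k + a′ * N p k) →
               (∀ i → i ≢ p → ∀ k → L i k ≈ M i k) →
               (∀ i → i ≢ p → ∀ k → L i k ≈ N i k) →
               D L ≈ a * D M + a′ * D N

    additive : ∀ p {L M N} → (∀ k → L p k ≈ M p k + N p k) →
               (∀ i → i ≢ p → ∀ k → L i k ≈ M i k) →
               (∀ i → i ≢ p → ∀ k → L i k ≈ N i k) →
               D L ≈ D M + D N
    additive p eq eqM eqN = trans
      (linear p 1# 1# (λ k → trans (eq k) (+-cong (sym (*-identityˡ _)) (sym (*-identityˡ _)))) eqM eqN)
      (+-cong (*-identityˡ _) (*-identityˡ _))

  open Multilinear

  -- Stated for a single pair of rows, because for `det` the pairs are reached one after another: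
  -- rows 0 and 1 by a direct expansion, the others by induction and swaps.
  Alternates : ∀ {n m} → (Matrix n m → Carrier) → Fin n → Fin n → Set (c Level.⊔ ℓ)
  Alternates D p q = ∀ M → (∀ k → M p k ≈ M q k) → D M ≈ 0#

  minor : ∀ {n} → Matrix (suc n) (suc n) → Fin (suc n) → Carrier
  minor M j = det λ i k → M (suc i) (punchIn j k)

  term : ∀ {n} → Matrix (suc n) (suc n) → Fin (suc n) → Carrier
  term M j = (- 1#) ^ toℕ j * (M zero j * minor M j)

  det-cong : ∀ {n} {M N : Matrix n n} → M ≈ₘ N → det M ≈ det N
  det-cong {zero}  eq = refl
  det-cong {suc n} eq = Σ.sum-cong-≋ {suc n} λ j → *-congˡ {(- 1#) ^ toℕ j}
    (*-cong (eq zero j) (det-cong {n} λ i k → eq (suc i) (punchIn j k)))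

  det-linear : ∀ {n} p a a′ {L M N : Matrix n n} →
               (∀ k → L p k ≈ a * M p k + a′ * N p k) →
               (∀ i → i ≢ p → ∀ k → L i k ≈ M i k) →
               (∀ i → i ≢ p → ∀ k → L i k ≈ N i k) →
               det L ≈ a * det M + a′ * det N
  det-linear {suc n} zero a a′ {L} {M} {N} eq eqM eqN = trans
    (Σ.sum-cong-≋ {suc n} λ j → begin
      (- 1#) ^ toℕ j * (L zero j * minor L j)
        ≈⟨ *-congˡ {(- 1#) ^ toℕ j} (*-congʳ (eq j)) ⟩
      (- 1#) ^ toℕ j * ((a * M zero j + a′ * N zero j) * minor L j)
        ≈⟨ solve 6 (λ s a a′ m n d → s :* ((a :* m :+ a′ :* n) :* d) := a :* (s :* (m :* d)) :+ a′ :* (s :* (n :* d))) refl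
             ((- 1#) ^ toℕ j) a a′ (M zero j) (N zero j) (minor L j) ⟩
      a * ((- 1#) ^ toℕ j * (M zero j * minor L j)) + a′ * ((- 1#) ^ toℕ j * (N zero j * minor L j))
        ≈⟨ +-cong (*-congˡ {a} (*-congˡ {(- 1#) ^ toℕ j} (*-congˡ {M zero j} (det-cong λ i k → eqM (suc i) (λ ()) (punchIn j k)))))
                  (*-congˡ {a′} (*-congˡ {(- 1#) ^ toℕ j} (*-congˡ {N zero j} (det-cong λ i k → eqN (suc i) (λ ()) (punchIn j k))))) ⟩
      a * ((- 1#) ^ toℕ j * (M zero j * minor M j)) + a′ * ((- 1#) ^ toℕ j * (N zero j * minor N j)) ∎)
    (sum-linear {suc n} a a′ (term M) (term N))
  det-linear {suc n} (suc p) a a′ {L} {M} {N} eq eqM eqN = trans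
    (Σ.sum-cong-≋ {suc n} λ j → begin
      (- 1#) ^ toℕ j * (L zero j * minor L j)
        ≈⟨ *-congˡ {(- 1#) ^ toℕ j} (*-congˡ {L zero j} (det-linear p a a′ (λ k → eq (punchIn j k))
             (λ i i≢p k → eqM (suc i) (i≢p ∘ Fin.suc-injective) (punchIn j k))
             (λ i i≢p k → eqN (suc i) (i≢p ∘ Fin.suc-injective) (punchIn j k)))) ⟩
      (- 1#) ^ toℕ j * (L zero j * (a * minor M j + a′ * minor N j))
        ≈⟨ solve 6 (λ s a a′ l m n → s :* (l :* (a :* m :+ a′ :* n)) := a :* (s :* (l :* m)) :+ a′ :* (s :* (l :* n))) refl
             ((- 1#) ^ toℕ j) a a′ (L zero j) (minor M j) (minor N j) ⟩
      a * ((- 1#) ^ toℕ j * (L zero j * minor M j)) + a′ * ((- 1#) ^ toℕ j * (L zero j * minor N j))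
        ≈⟨ +-cong (*-congˡ {a} (*-congˡ {(- 1#) ^ toℕ j} (*-congʳ (eqM zero (λ ()) j))))
                  (*-congˡ {a′} (*-congˡ {(- 1#) ^ toℕ j} (*-congʳ (eqN zero (λ ()) j)))) ⟩
      a * ((- 1#) ^ toℕ j * (M zero j * minor M j)) + a′ * ((- 1#) ^ toℕ j * (N zero j * minor N j)) ∎)
    (sum-linear {suc n} a a′ (term M) (term N))

  det-multilinear : ∀ {n} → Multilinear {n} det
  det-multilinear = record { D-cong = det-cong ; linear = det-linear }

  setRows : ∀ {n m} → Matrix n m → (p q : Fin n) → (u v : Fin m → Carrier) → Matrix n m
  setRows M p q u v = updateAt (updateAt M p (const u)) q (const v)

  module _ {n m : ℕ} (M : Matrix n m) {p q : Fin n} (p≢q : p ≢ q) where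

    setRows-p : ∀ u v k → setRows M p q u v p k ≡ u k
    setRows-p u v k = ≡.cong (λ r → r k)
      (≡.trans (updateAt-minimal p q _ p≢q) (updateAt-updates p M))

    setRows-q : ∀ u v k → setRows M p q u v q k ≡ v k
    setRows-q u v k = ≡.cong (λ r → r k) (updateAt-updates q (updateAt M p (const u)))

    setRows-other : ∀ u v i → i ≢ p → i ≢ q → ∀ k → setRows M p q u v i k ≡ M i k
    setRows-other u v i i≢p i≢q k = ≡.cong (λ r → r k)
      (≡.trans (updateAt-minimal i q _ i≢q) (updateAt-minimal i p M i≢p))

    setRows-p-cong : ∀ u u′ v i → i ≢ p → ∀ k → setRows M p q u v i k ≡ setRows M p q u′ v i k
    setRows-p-cong u u′ v i i≢p k with i Fin.≟ q
    ... | yes ≡.refl = ≡.trans (setRows-q u v k) (≡.sym (setRows-q u′ v k))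
    ... | no i≢q = ≡.trans (setRows-other u v i i≢p i≢q k) (≡.sym (setRows-other u′ v i i≢p i≢q k))

    setRows-q-cong : ∀ u v v′ i → i ≢ q → ∀ k → setRows M p q u v i k ≡ setRows M p q u v′ i k
    setRows-q-cong u v v′ i i≢q k with i Fin.≟ p
    ... | yes ≡.refl = ≡.trans (setRows-p u v k) (≡.sym (setRows-p u v′ k))
    ... | no i≢p = ≡.trans (setRows-other u v i i≢p i≢q k) (≡.sym (setRows-other u v′ i i≢p i≢q k))

    setRows-self : setRows M p q (M p) (M q) ≈ₘ M
    setRows-self i k with i Fin.≟ p | i Fin.≟ q
    ... | yes ≡.refl | _          = reflexive (setRows-p (M p) (M q) k)
    ... | no _       | yes ≡.refl = reflexive (setRows-q (M p) (M q) k)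
    ... | no i≢p     | no i≢q     = reflexive (setRows-other (M p) (M q) i i≢p i≢q k)

    -- Polarisation: rows p and q are both replaced by their sum, and of the four terms of the
    -- expansion the two with equal rows vanish.
    swap-rows : ∀ {D} → Multilinear D → Alternates D p q →
                D (setRows M p q (M q) (M p)) ≈ - 1# * D M
    swap-rows {D} ml alt = x+y≈0⇒y≈-1*x (sym (begin
      0#                                ≈⟨ vanish S ⟨
      D (rows S S)                      ≈⟨ addp (M p) (M q) S ⟩
      D (rows (M p) S) + D (rows (M q) S)
        ≈⟨ +-cong (addq (M p) (M p) (M q)) (addq (M q) (M p) (M q)) ⟩
      (D (rows (M p) (M p)) + D (rows (M p) (M q))) + (D (rows (M q) (M p)) + D (rows (M q) (M q)))
        ≈⟨ +-cong (+-cong (vanish (M p)) (D-cong ml setRows-self)) (+-congˡ (vanish (M q))) ⟩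
      (0# + D M) + (D (rows (M q) (M p)) + 0#)
        ≈⟨ +-cong (+-identityˡ _) (+-identityʳ _) ⟩
      D M + D (rows (M q) (M p))        ∎))
      where
      rows = setRows M p q
      S : Fin m → Carrier
      S k = M p k + M q k

      vanish : ∀ u → D (rows u u) ≈ 0#
      vanish u = alt _ λ k → reflexive (≡.trans (setRows-p u u k) (≡.sym (setRows-q u u k)))

      addp : ∀ u v w → D (rows (λ k → u k + v k) w) ≈ D (rows u w) + D (rows v w)
      addp u v w = additive ml p
        (λ k → reflexive (≡.trans (setRows-p _ w k) (≡.cong₂ _+_ (≡.sym (setRows-p u w k)) (≡.sym (setRows-p v w k)))))
        (λ i i≢p k → reflexive (setRows-p-cong _ u w i i≢p k))
        (λ i i≢p k → reflexive (setRows-p-cong _ v w i i≢p k))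

      addq : ∀ w u v → D (rows w (λ k → u k + v k)) ≈ D (rows w u) + D (rows w v)
      addq w u v = additive ml q
        (λ k → reflexive (≡.trans (setRows-q w _ k) (≡.cong₂ _+_ (≡.sym (setRows-q w u k)) (≡.sym (setRows-q w v k)))))
        (λ i i≢q k → reflexive (setRows-q-cong w _ u i i≢q k))
        (λ i i≢q k → reflexive (setRows-q-cong w _ v i i≢q k))

  -- The pairs (j , punchIn j k) are matched with their transposes.
  sum-antisymmetric : ∀ {n} (g : Fin (suc n) → Fin n → Carrier) →
                      (∀ l k → l Fin.≤ k → g (inject₁ l) k + g (suc k) l ≈ 0#) →
                      sum (λ j → sum (g j)) ≈ 0#
  sum-antisymmetric {zero}  g anti = +-identityˡ 0#
  sum-antisymmetric {suc n} g anti = begin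
    sum (g zero) + sum (λ j → g (suc j) zero + sum (λ k → g (suc j) (suc k)))
      ≈⟨ +-congˡ (Σ.∑-distrib-+ {suc n} (λ j → g (suc j) zero) (λ j → sum (λ k → g (suc j) (suc k)))) ⟩
    sum (g zero) + (sum (λ j → g (suc j) zero) + sum (λ j → sum (λ k → g (suc j) (suc k))))
      ≈⟨ +-congˡ (+-congˡ (sum-antisymmetric (λ j k → g (suc j) (suc k)) λ l k l≤k → anti (suc l) (suc k) (s≤s l≤k))) ⟩
    sum (g zero) + (sum (λ j → g (suc j) zero) + 0#)
      ≈⟨ +-congˡ (+-identityʳ _) ⟩
    sum (g zero) + sum (λ j → g (suc j) zero)
      ≈⟨ Σ.∑-distrib-+ {suc n} (g zero) (λ j → g (suc j) zero) ⟨
    sum (λ k → g zero k + g (suc k) zero)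
      ≈⟨ sum-zero {suc n} (λ k → g zero k + g (suc k) zero) (λ k → anti zero k z≤n) ⟩
    0# ∎

  punchIn-inject₁ : ∀ {n} (l k : Fin n) → l Fin.≤ k → punchIn (inject₁ l) k ≡ suc k
  punchIn-inject₁ zero    k       _         = ≡.refl
  punchIn-inject₁ (suc l) (suc k) (s≤s l≤k) = ≡.cong suc (punchIn-inject₁ l k l≤k)

  punchIn-suc : ∀ {n} (l k : Fin n) → l Fin.≤ k → punchIn (suc k) l ≡ inject₁ l
  punchIn-suc zero    k       _         = ≡.refl
  punchIn-suc (suc l) (suc k) (s≤s l≤k) = ≡.cong suc (punchIn-suc l k l≤k)

  punchIn-punchIn : ∀ {n} (l k : Fin (suc n)) m → l Fin.≤ k →
                    punchIn (inject₁ l) (punchIn k m) ≡ punchIn (suc k) (punchIn l m)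
  punchIn-punchIn zero    k       m       _         = ≡.refl
  punchIn-punchIn (suc l) (suc k) zero    _         = ≡.refl
  punchIn-punchIn (suc l) (suc k) (suc m) (s≤s l≤k) = ≡.cong suc (punchIn-punchIn l k m l≤k)

  -- After two expansions the terms are indexed by ordered pairs of distinct columns. The two orders
  -- of columns l and k + 1 leave the same second minor, by `punchIn-punchIn`, and carry the signs
  -- (-1)^(l + k) and (-1)^(k + 1 + l).
  det-alternates₀₁ : ∀ {n} → Alternates {suc (suc n)} det zero (suc zero)
  det-alternates₀₁ {n} M eq = begin
    det M
      ≈⟨ Σ.sum-cong-≋ {suc (suc n)} (λ j → trans (*-congˡ {(- 1#) ^ toℕ j} (Σ.*-distribˡ-sum {suc n} (M zero j) (inner j)))
           (Σ.*-distribˡ-sum {suc n} ((- 1#) ^ toℕ j) (λ k → M zero j * inner j k))) ⟩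
    sum (λ j → sum (g j))
      ≈⟨ sum-antisymmetric g anti ⟩
    0# ∎
    where
    minor₂ : Fin (suc (suc n)) → Fin (suc n) → Carrier
    minor₂ j k = det λ i l → M (suc (suc i)) (punchIn j (punchIn k l))

    inner g : Fin (suc (suc n)) → Fin (suc n) → Carrier
    inner j k = (- 1#) ^ toℕ k * (M (suc zero) (punchIn j k) * minor₂ j k)
    g j k = (- 1#) ^ toℕ j * (M zero j * inner j k)

    anti : ∀ l k → l Fin.≤ k → g (inject₁ l) k + g (suc k) l ≈ 0#
    anti l k l≤k = begin
      g (inject₁ l) k + g (suc k) l
        ≈⟨ +-cong
             (*-cong (reflexive (≡.cong ((- 1#) ^_) (Fin.toℕ-inject₁ l)))
               (*-congˡ {a} (*-congˡ {t} (*-congʳ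
                 (trans (reflexive (≡.cong (M (suc zero)) (punchIn-inject₁ l k l≤k))) (sym (eq (suc k))))))))
             (*-congˡ { - 1# * t} (*-congˡ {M zero (suc k)} (*-congˡ {s} (*-cong
               (trans (reflexive (≡.cong (M (suc zero)) (punchIn-suc l k l≤k))) (sym (eq (inject₁ l))))
               (det-cong λ i m → reflexive (≡.cong (M (suc (suc i))) (≡.sym (punchIn-punchIn l k m l≤k)))))))) ⟩
      s * (a * (t * (a′ * e))) + (- 1# * t) * (a′ * (s * (a * e)))
        ≈⟨ solve 6 (λ s t a a′ e m → s :* (a :* (t :* (a′ :* e))) :+ (m :* t) :* (a′ :* (s :* (a :* e)))
             := s :* (a :* (t :* (a′ :* e))) :+ m :* (s :* (a :* (t :* (a′ :* e))))) refl s t a a′ e (- 1#) ⟩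
      s * (a * (t * (a′ * e))) + - 1# * (s * (a * (t * (a′ * e))))
        ≈⟨ x+-1*x≈0 _ ⟩
      0# ∎
      where
      s = (- 1#) ^ toℕ l
      t = (- 1#) ^ toℕ k
      a = M zero (inject₁ l)
      a′ = M zero (suc k)
      e = minor₂ (inject₁ l) k

  -1*x≈0⇒x≈0 : ∀ {x} → 0# ≈ - 1# * x → x ≈ 0#
  -1*x≈0⇒x≈0 {x} eq = begin
    x             ≈⟨ +-identityʳ x ⟨
    x + 0#        ≈⟨ +-congˡ eq ⟩
    x + - 1# * x  ≈⟨ x+-1*x≈0 x ⟩
    0#            ∎

  det-alternates : ∀ {n} {p q : Fin n} → p ≢ q → Alternates {n} det p q
  det-alternates-suc : ∀ {n} {p q : Fin n} → p ≢ q → Alternates {suc n} det (suc p) (suc q)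
  det-alternates-zero : ∀ {n} {q : Fin n} → Alternates {suc n} det zero (suc q)

  det-alternates {suc n} {zero}  {zero}  p≢q M eq = ⊥-elim (p≢q ≡.refl)
  det-alternates {suc n} {zero}  {suc q} p≢q M eq = det-alternates-zero M eq
  det-alternates {suc n} {suc p} {zero}  p≢q M eq = det-alternates-zero M (λ k → sym (eq k))
  det-alternates {suc n} {suc p} {suc q} p≢q M eq = det-alternates-suc (p≢q ∘ ≡.cong suc) M eq

  det-alternates-suc {n} p≢q M eq = sum-zero {suc n} (term M) λ j → trans
    (*-congˡ {(- 1#) ^ toℕ j} (trans (*-congˡ {M zero j}
      (det-alternates p≢q (λ i k → M (suc i) (punchIn j k)) (λ k → eq (punchIn j k))))
      (zeroʳ _))) (zeroʳ _)

  det-alternates-zero {suc n} {zero}  M eq = det-alternates₀₁ M eq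
  -- Swapping row 1 with row q + 2 makes rows 0 and 1 equal. Both swapped rows lie below row 0, so
  -- the sign change rests only on smaller determinants.
  det-alternates-zero {suc n} {suc q} M eq = -1*x≈0⇒x≈0 (trans
    (sym (det-alternates₀₁ (setRows M (suc zero) (suc (suc q)) (M (suc (suc q))) (M (suc zero))) eq))
    (swap-rows M {suc zero} {suc (suc q)} (λ ()) det-multilinear
      (det-alternates-suc {p = zero} {suc q} λ ())))

  record AlternatingForm {n m} (D : Matrix n m → Carrier) : Set (c Level.⊔ ℓ) where
    field
      multilinear : Multilinear D
      alternates  : ∀ {p q} → p ≢ q → Alternates D p q

  open AlternatingForm using (multilinear; alternates)

  ∷-cong : ∀ {n m} {u v : Fin m → Carrier} {M N : Matrix n m} →
           (∀ k → u k ≈ v k) → M ≈ₘ N → (u ∷ M) ≈ₘ (v ∷ N)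
  ∷-cong eq eq′ zero    = eq
  ∷-cong eq eq′ (suc i) = eq′ i

  head∷tail : ∀ {n m} (M : Matrix (suc n) m) → M ≈ₘ (M zero ∷ (M ∘ suc))
  head∷tail M zero    k = refl
  head∷tail M (suc i) k = refl

  fixHead-multilinear : ∀ {n m} {D : Matrix (suc n) m → Carrier} u →
                        Multilinear D → Multilinear (λ M → D (u ∷ M))
  fixHead-multilinear u ml = record
    { D-cong = λ eq → D-cong ml (∷-cong (λ _ → refl) eq)
    ; linear = λ p a a′ eq eqM eqN → linear ml (suc p) a a′ eq
        (λ { zero _ k → refl ; (suc i) ne → eqM i (ne ∘ ≡.cong suc) })
        (λ { zero _ k → refl ; (suc i) ne → eqN i (ne ∘ ≡.cong suc) })
    }

  fixHead : ∀ {n m} {D : Matrix (suc n) m → Carrier} u →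
            AlternatingForm D → AlternatingForm (λ M → D (u ∷ M))
  fixHead u af = record
    { multilinear = fixHead-multilinear u (multilinear af)
    ; alternates  = λ p≢q M eq → alternates af (p≢q ∘ Fin.suc-injective) _ eq
    }

  -- Row by row, linearity splits off a multiple of a matrix that has `e` as a row, and `D` kills
  -- it. With `e = δ j` this clears column j below a frozen first row `δ j`.
  add-multiples : ∀ {n m} {D : Matrix n m → Carrier} → Multilinear D → ∀ (e : Fin m → Carrier) →
                  (∀ p (M : Matrix n m) → (∀ k → M p k ≈ e k) → D M ≈ 0#) →
                  ∀ (a : Fin n → Carrier) (M : Matrix n m) → D (λ i k → M i k + a i * e k) ≈ D M
  add-multiples {zero}  ml e kill a M = D-cong ml λ ()
  add-multiples {suc n} {D = D} ml e kill a M = begin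
    D (λ i k → M i k + a i * e k)
      ≈⟨ D-cong ml (head∷tail _) ⟩
    D (u ∷ λ i k → M (suc i) k + a (suc i) * e k)
      ≈⟨ add-multiples (fixHead-multilinear u ml) e (λ p M eq → kill (suc p) _ eq) (a ∘ suc) (M ∘ suc) ⟩
    D (u ∷ (M ∘ suc))
      ≈⟨ linear ml zero 1# (a zero) {M = M} {N = e ∷ (M ∘ suc)}
           (λ k → +-congʳ (sym (*-identityˡ _)))
           (λ { zero ne → ⊥-elim (ne ≡.refl) ; (suc i) _ k → refl })
           (λ { zero ne → ⊥-elim (ne ≡.refl) ; (suc i) _ k → refl }) ⟩
    1# * D M + a zero * D (e ∷ (M ∘ suc))
      ≈⟨ +-cong (*-identityˡ _) (trans (*-congˡ {a zero} (kill zero _ λ k → refl)) (zeroʳ _)) ⟩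
    D M + 0#
      ≈⟨ +-identityʳ _ ⟩
    D M ∎
    where
    u : Fin _ → Carrier
    u k = M zero k + a zero * e k

  -- With row 0 frozen, row j + 1 moves up to position 1 by induction; one last swap with row 0
  -- gives the remaining sign.
  move-to-front : ∀ {n m} {D : Matrix (suc n) m → Carrier} → AlternatingForm D →
                  ∀ j M → D (M j ∷ (M ∘ punchIn j)) ≈ (- 1#) ^ toℕ j * D M
  move-to-front {D = D} af zero M = trans
    (D-cong (multilinear af) (λ i k → sym (head∷tail M i k))) (sym (*-identityˡ _))
  move-to-front {suc n} {D = D} af (suc j) M = begin
    D (M (suc j) ∷ (M ∘ punchIn (suc j)))
      ≈⟨ D-cong (multilinear af) (λ { zero k → refl ; (suc zero) k → refl ; (suc (suc i)) k → refl }) ⟩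
    D (setRows N zero (suc zero) (N (suc zero)) (N zero))
      ≈⟨ swap-rows N {zero} {suc zero} (λ ()) (multilinear af) (alternates af {zero} {suc zero} λ ()) ⟩
    - 1# * D N
      ≈⟨ *-congˡ { - 1#} (move-to-front (fixHead (M zero) af) j (M ∘ suc)) ⟩
    - 1# * ((- 1#) ^ toℕ j * D (M zero ∷ (M ∘ suc)))
      ≈⟨ *-congˡ { - 1#} (*-congˡ {(- 1#) ^ toℕ j} (D-cong (multilinear af) λ i k → sym (head∷tail M i k))) ⟩
    - 1# * ((- 1#) ^ toℕ j * D M)
      ≈⟨ *-assoc _ _ _ ⟨
    - 1# * (- 1#) ^ toℕ j * D M ∎
    where
    N : Matrix (suc (suc n)) _
    N = M zero ∷ (M (suc j) ∷ (M ∘ suc ∘ punchIn j))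

  δ : ∀ {n} → Matrix n n
  δ zero    zero    = 1#
  δ zero    (suc k) = 0#
  δ (suc i) zero    = 0#
  δ (suc i) (suc k) = δ i k

  -- Puts a row of a minor back to full width, with 0 in the deleted column j. Through it a form on
  -- wide matrices becomes a form on the minors.
  insertZero : ∀ {n} → Fin (suc n) → (Fin n → Carrier) → Fin (suc n) → Carrier
  insertZero zero              v zero    = 0#
  insertZero zero              v (suc k) = v k
  insertZero {suc n} (suc j) v zero    = v zero
  insertZero {suc n} (suc j) v (suc k) = insertZero j (v ∘ suc) k

  insertZero-linear : ∀ {n} (j : Fin (suc n)) a a′ {u v w} → (∀ k → u k ≈ a * v k + a′ * w k) →
                      ∀ k → insertZero j u k ≈ a * insertZero j v k + a′ * insertZero j w k
  insertZero-linear zero              a a′ eq zero    = sym (trans (+-cong (zeroʳ a) (zeroʳ a′)) (+-identityˡ 0#))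
  insertZero-linear zero              a a′ eq (suc k) = eq k
  insertZero-linear {suc n} (suc j) a a′ eq zero    = eq zero
  insertZero-linear {suc n} (suc j) a a′ eq (suc k) = insertZero-linear j a a′ (eq ∘ suc) k

  insertZero-cong : ∀ {n} (j : Fin (suc n)) {u v} → (∀ k → u k ≈ v k) →
                    ∀ k → insertZero j u k ≈ insertZero j v k
  insertZero-cong zero            eq zero    = refl
  insertZero-cong zero            eq (suc k) = eq k
  insertZero-cong {suc n} (suc j) eq zero    = eq zero
  insertZero-cong {suc n} (suc j) eq (suc k) = insertZero-cong j (eq ∘ suc) k

  insertZero-δ : ∀ {n} (j : Fin (suc n)) i k → insertZero j (δ i) k ≈ δ (punchIn j i) k
  insertZero-δ zero            i       zero    = refl
  insertZero-δ zero            i       (suc k) = refl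
  insertZero-δ {suc n} (suc j) zero    zero    = refl
  insertZero-δ {suc n} (suc j) (suc i) zero    = refl
  insertZero-δ {suc n} (suc j) zero    (suc k) = insertZero-0 j k
    where
    insertZero-0 : ∀ {n} (j : Fin (suc n)) k → insertZero j (λ _ → 0#) k ≈ 0#
    insertZero-0 zero            zero    = refl
    insertZero-0 zero            (suc k) = refl
    insertZero-0 {suc n} (suc j) zero    = refl
    insertZero-0 {suc n} (suc j) (suc k) = insertZero-0 j k
  insertZero-δ {suc n} (suc j) (suc i) (suc k) = insertZero-δ j i k

  insertZero-split : ∀ {n} (j : Fin (suc n)) (u : Fin (suc n) → Carrier) k →
                     u k ≈ insertZero j (u ∘ punchIn j) k + u j * δ j k
  insertZero-split zero u zero    = sym (trans (+-identityˡ _) (*-identityʳ _))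
  insertZero-split zero u (suc k) = sym (trans (+-congˡ (zeroʳ _)) (+-identityʳ _))
  insertZero-split {suc n} (suc j) u zero    = sym (trans (+-congˡ (zeroʳ _)) (+-identityʳ _))
  insertZero-split {suc n} (suc j) u (suc k) = insertZero-split j (u ∘ suc) k

  insertColumn : ∀ {n} {D : Matrix n (suc n) → Carrier} j → AlternatingForm D →
                 AlternatingForm (λ M → D (λ i → insertZero j (M i)))
  insertColumn j af = record
    { multilinear = record
      { D-cong = λ eq → D-cong ml λ i → insertZero-cong j (eq i)
      ; linear = λ p a a′ eq eqM eqN → linear ml p a a′ (insertZero-linear j a a′ eq)
          (λ i ne → insertZero-cong j (eqM i ne)) (λ i ne → insertZero-cong j (eqN i ne))
      }
    ; alternates = λ p≢q M eq → alternates af p≢q _ (insertZero-cong j eq)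
    }
    where ml = multilinear af

  sum-δ : ∀ {n} (i : Fin n) (f : Fin n → Carrier) → sum (λ k → δ i k * f k) ≈ f i
  sum-δ {suc n} zero f = begin
    1# * f zero + sum (λ k → 0# * f (suc k))  ≈⟨ +-cong (*-identityˡ _) (sum-zero {n} (λ k → 0# * f (suc k)) λ k → zeroˡ (f (suc k))) ⟩
    f zero + 0#                               ≈⟨ +-identityʳ _ ⟩
    f zero                                    ∎
  sum-δ {suc n} (suc i) f = begin
    0# * f zero + sum (λ k → δ i k * f (suc k))  ≈⟨ +-cong (zeroˡ _) (sum-δ i (f ∘ suc)) ⟩
    0# + f (suc i)                               ≈⟨ +-identityˡ _ ⟩
    f (suc i)                                    ∎

  linear-sum : ∀ {n m} {D : Matrix (suc n) m → Carrier} → Multilinear D →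
               ∀ {l} (a : Fin l → Carrier) (U : Matrix l m) M →
               D ((λ k → sum λ j → a j * U j k) ∷ M) ≈ sum λ j → a j * D (U j ∷ M)
  linear-sum {D = D} ml {zero} a U M = begin
    D ((λ k → 0#) ∷ M)
      ≈⟨ linear ml zero 0# 0# {M = (λ k → 0#) ∷ M} {N = (λ k → 0#) ∷ M}
           (λ k → sym (trans (+-cong (zeroˡ _) (zeroˡ _)) (+-identityˡ _)))
           (λ { zero ne → ⊥-elim (ne ≡.refl) ; (suc i) _ k → refl })
           (λ { zero ne → ⊥-elim (ne ≡.refl) ; (suc i) _ k → refl }) ⟩
    0# * D ((λ k → 0#) ∷ M) + 0# * D ((λ k → 0#) ∷ M)
      ≈⟨ trans (+-cong (zeroˡ _) (zeroˡ _)) (+-identityˡ _) ⟩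
    0# ∎
  linear-sum {D = D} ml {suc l} a U M = begin
    D ((λ k → a zero * U zero k + sum λ j → a (suc j) * U (suc j) k) ∷ M)
      ≈⟨ linear ml zero (a zero) 1# {M = U zero ∷ M} {N = (λ k → sum λ j → a (suc j) * U (suc j) k) ∷ M}
           (λ k → +-congˡ (sym (*-identityˡ _)))
           (λ { zero ne → ⊥-elim (ne ≡.refl) ; (suc i) _ k → refl })
           (λ { zero ne → ⊥-elim (ne ≡.refl) ; (suc i) _ k → refl }) ⟩
    a zero * D (U zero ∷ M) + 1# * D ((λ k → sum λ j → a (suc j) * U (suc j) k) ∷ M)
      ≈⟨ +-congˡ (trans (*-identityˡ _) (linear-sum ml (a ∘ suc) (U ∘ suc) M)) ⟩
    a zero * D (U zero ∷ M) + sum (λ j → a (suc j) * D (U (suc j) ∷ M)) ∎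

  -- Laplace expansion of an arbitrary form. Row 0 is written in the basis `δ`; under each `δ j`
  -- column j is cleared, so what remains is an alternating form of the minor, to which the
  -- induction applies. Moving `δ j` back to row j of the identity matrix produces the sign that
  -- occurs in `det`.
  alternating-unique : ∀ {n} {D : Matrix n n → Carrier} → AlternatingForm D →
                       ∀ M → D M ≈ det M * D δ
  alternating-unique {zero}  af M = trans (D-cong (multilinear af) λ ()) (sym (*-identityˡ _))
  alternating-unique {suc n} {D} af M = begin
    D M
      ≈⟨ D-cong ml (head∷tail M) ⟩
    D (M zero ∷ (M ∘ suc))
      ≈⟨ D-cong ml (∷-cong (λ k → sym (sum-δʳ (M zero) k)) λ i k → refl) ⟩
    D ((λ k → sum λ j → M zero j * δ j k) ∷ (M ∘ suc))
      ≈⟨ linear-sum ml (M zero) δ (M ∘ suc) ⟩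
    sum (λ j → M zero j * D (δ j ∷ (M ∘ suc)))
      ≈⟨ Σ.sum-cong-≋ {suc n} (λ j → trans (*-congˡ {M zero j} (column j))
           (solve 4 (λ a d s e → a :* (d :* (s :* e)) := (s :* (a :* d)) :* e) refl
             (M zero j) (minor M j) ((- 1#) ^ toℕ j) (D δ))) ⟩
    sum (λ j → (- 1#) ^ toℕ j * (M zero j * minor M j) * D δ)
      ≈⟨ Σ.*-distribʳ-sum {suc n} (D δ) (λ j → (- 1#) ^ toℕ j * (M zero j * minor M j)) ⟨
    det M * D δ ∎
    where
    ml = multilinear af

    sum-δʳ : ∀ {n} (f : Fin n → Carrier) k → sum (λ j → f j * δ j k) ≈ f k
    sum-δʳ {suc n} f zero = begin
      f zero * 1# + sum (λ j → f (suc j) * 0#)  ≈⟨ +-cong (*-identityʳ _) (sum-zero {n} (λ j → f (suc j) * 0#) λ j → zeroʳ (f (suc j))) ⟩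
      f zero + 0#                               ≈⟨ +-identityʳ _ ⟩
      f zero                                    ∎
    sum-δʳ {suc n} f (suc k) = trans (+-cong (zeroʳ _) (sum-δʳ (f ∘ suc) k)) (+-identityˡ _)

    column : ∀ j → D (δ j ∷ (M ∘ suc)) ≈ minor M j * ((- 1#) ^ toℕ j * D δ)
    column j = begin
      D (δ j ∷ (M ∘ suc))
        ≈⟨ D-cong ml (∷-cong (λ k → refl) λ i → insertZero-split j (M (suc i))) ⟩
      D (δ j ∷ λ i k → insertZero j (M (suc i) ∘ punchIn j) k + M (suc i) j * δ j k)
        ≈⟨ add-multiples (fixHead-multilinear (δ j) ml) (δ j)
             (λ p N eq → alternates af {zero} {suc p} (λ ()) (δ j ∷ N) (λ k → sym (eq k)))
             (λ i → M (suc i) j) (λ i → insertZero j (M (suc i) ∘ punchIn j)) ⟩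
      D (δ j ∷ λ i → insertZero j (M (suc i) ∘ punchIn j))
        ≈⟨ alternating-unique (insertColumn j (fixHead (δ j) af)) (λ i → M (suc i) ∘ punchIn j) ⟩
      minor M j * D (δ j ∷ λ i → insertZero j (δ i))
        ≈⟨ *-congˡ {minor M j} (D-cong ml (∷-cong (λ k → refl) (insertZero-δ j))) ⟩
      minor M j * D (δ j ∷ (δ ∘ punchIn j))
        ≈⟨ *-congˡ {minor M j} (move-to-front af j δ) ⟩
      minor M j * ((- 1#) ^ toℕ j * D δ) ∎

  infixl 7 _⊗_
  _⊗_ : ∀ {n l m} → Matrix n l → Matrix l m → Matrix n m
  (M ⊗ N) i j = sum λ k → M i k * N k j

  -- For fixed `N` the left side is an alternating form of the rows of `M`, and its value at the
  -- identity matrix is `det N`.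
  det-⊗ : ∀ {n} (M N : Matrix n n) → det (M ⊗ N) ≈ det M * det N
  det-⊗ {n} M N = trans
    (alternating-unique {D = λ M → det (M ⊗ N)} (record
      { multilinear = record
        { D-cong = λ eq → det-cong (λ i j → row-cong (eq i) j)
        ; linear = λ p a a′ {L} {M} {M′} eq eqM eqM′ → det-linear p a a′
            (λ j → trans
              (Σ.sum-cong-≋ {n} λ k → trans (*-congʳ (eq k))
                (solve 5 (λ a a′ m m′ n → (a :* m :+ a′ :* m′) :* n := a :* (m :* n) :+ a′ :* (m′ :* n)) refl
                  a a′ (M p k) (M′ p k) (N k j)))
              (sum-linear {n} a a′ (λ k → M p k * N k j) (λ k → M′ p k * N k j)))
            (λ i ne j → row-cong (eqM i ne) j)
            (λ i ne j → row-cong (eqM′ i ne) j)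
        }
      ; alternates = λ p≢q M eq → det-alternates p≢q _ (row-cong eq)
      }) M)
    (*-congˡ {det M} (det-cong λ i j → sum-δ i λ k → N k j))
    where
    row-cong : ∀ {u v : Fin n → Carrier} → (∀ k → u k ≈ v k) →
               ∀ j → sum (λ k → u k * N k j) ≈ sum (λ k → v k * N k j)
    row-cong eq j = Σ.sum-cong-≋ {n} λ k → *-congʳ (eq k)

  det-lower-block : ∀ {n} (M : Matrix (suc n) (suc n)) → (∀ j → M zero (suc j) ≈ 0#) →
                    det M ≈ M zero zero * det (λ i j → M (suc i) (suc j))
  det-lower-block {n} M eq = begin
    1# * (M zero zero * det (λ i j → M (suc i) (suc j))) + sum (term M ∘ suc)
      ≈⟨ +-cong (*-identityˡ _) (sum-zero {n} (term M ∘ suc) λ j → trans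
           (*-congˡ {(- 1#) ^ suc (toℕ j)} (trans (*-congʳ (eq j)) (zeroˡ _))) (zeroʳ _)) ⟩
    M zero zero * det (λ i j → M (suc i) (suc j)) + 0#
      ≈⟨ +-identityʳ _ ⟩
    M zero zero * det (λ i j → M (suc i) (suc j)) ∎

  det-zero-column : ∀ {n} (M : Matrix (suc n) (suc n)) → (∀ i → M i zero ≈ 0#) → det M ≈ 0#
  det-zero-column {n} M eq = sum-zero {suc n} (term M) λ j →
    trans (*-congˡ {(- 1#) ^ toℕ j} (entry-minor≈0 n M eq j)) (zeroʳ _)
    where
    entry-minor≈0 : ∀ n (M : Matrix (suc n) (suc n)) → (∀ i → M i zero ≈ 0#) → ∀ j →
                    M zero j * det (λ i k → M (suc i) (punchIn j k)) ≈ 0#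
    entry-minor≈0 n       M eq zero    = trans (*-congʳ (eq zero)) (zeroˡ _)
    entry-minor≈0 (suc n) M eq (suc j) = trans
      (*-congˡ {M zero (suc j)} (det-zero-column (λ i k → M (suc i) (punchIn (suc j) k)) (eq ∘ suc))) (zeroʳ _)

  -- The expansion still runs along row 0, whose entries are arbitrary; the terms after the first
  -- vanish because their minors retain the zero part of column 0.
  det-upper-block : ∀ {n} (M : Matrix (suc n) (suc n)) → (∀ i → M (suc i) zero ≈ 0#) →
                    det M ≈ M zero zero * det (λ i j → M (suc i) (suc j))
  det-upper-block {zero}  M eq = trans (+-identityʳ _) (*-identityˡ _)
  det-upper-block {suc n} M eq = begin
    1# * (M zero zero * det (λ i j → M (suc i) (suc j))) + sum (term M ∘ suc)
      ≈⟨ +-cong (*-identityˡ _) (sum-zero {suc n} (term M ∘ suc) λ j → trans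
           (*-congˡ {(- 1#) ^ suc (toℕ j)} (trans
             (*-congˡ {M zero (suc j)} (det-zero-column (λ i k → M (suc i) (punchIn (suc j) k)) eq)) (zeroʳ _))) (zeroʳ _)) ⟩
    M zero zero * det (λ i j → M (suc i) (suc j)) + 0#
      ≈⟨ +-identityʳ _ ⟩
    M zero zero * det (λ i j → M (suc i) (suc j)) ∎

  det-upper-unitriangular : ∀ {n} (M : Matrix n n) → (∀ i j → j Fin.< i → M i j ≈ 0#) →
                            (∀ i → M i i ≈ 1#) → det M ≈ 1#
  det-upper-unitriangular {zero}  M lower diag = refl
  det-upper-unitriangular {suc n} M lower diag = trans
    (det-upper-block M (λ i → lower (suc i) zero (s≤s z≤n)))
    (trans (*-cong (diag zero) (det-upper-unitriangular (λ i j → M (suc i) (suc j))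
             (λ i j j<i → lower (suc i) (suc j) (s≤s j<i)) (diag ∘ suc)))
      (*-identityˡ _))

-- Non-zero-divisors.

module Cancellation {c ℓ} (R : CommutativeRing c ℓ) where
  open RingNotation R
  open SetoidReasoning setoid

  Cancellable : Carrier → Set (c Level.⊔ ℓ)
  Cancellable a = ∀ {f g} → a * f ≈ a * g → f ≈ g

  cancellable-cong : ∀ {a a′} → a ≈ a′ → Cancellable a → Cancellable a′
  cancellable-cong a≈a′ cancel eq = cancel (trans (*-congʳ a≈a′) (trans eq (*-congʳ (sym a≈a′))))

  cancellable-1 : Cancellable 1#
  cancellable-1 eq = trans (sym (*-identityˡ _)) (trans eq (*-identityˡ _))

  cancellable-* : ∀ {a a′} → Cancellable a → Cancellable a′ → Cancellable (a * a′)
  cancellable-* cancel cancel′ eq = cancel′ (cancel (trans (sym (*-assoc _ _ _)) (trans eq (*-assoc _ _ _))))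

  cancellable-product : ∀ {n} (t : Fin n → Carrier) → (∀ i → Cancellable (t i)) → Cancellable (product t)
  cancellable-product {zero}  t cancel = cancellable-1
  cancellable-product {suc n} t cancel =
    cancellable-* (cancel zero) (cancellable-product (t ∘ suc) (cancel ∘ suc))

  cancellable : ∀ {a} → (∀ f → a * f ≈ 0# → f ≈ 0#) → Cancellable a
  cancellable {a} regular {f} {g} eq = begin
    f            ≈⟨ +-identityʳ f ⟨
    f + 0#       ≈⟨ +-congˡ (-‿inverseˡ g) ⟨
    f + (- g + g) ≈⟨ +-assoc f (- g) g ⟨
    f - g + g    ≈⟨ +-congʳ (regular (f - g) (begin
      a * (f - g)      ≈⟨ distribˡ a f (- g) ⟩
      a * f + a * - g  ≈⟨ +-congˡ (RingProperties.-‿distribʳ-* ring a g) ⟨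
      a * f - a * g    ≈⟨ +-congʳ eq ⟩
      a * g - a * g    ≈⟨ -‿inverseʳ _ ⟩
      0#               ∎)) ⟩
    0# + g       ≈⟨ +-identityˡ g ⟩
    g            ∎

-- Powers of products.

module Products {c ℓ} (R : CommutativeRing c ℓ) where
  open RingNotation R
  open SetoidReasoning setoid
  private
    module Π = CommutativeMonoidSum *-commutativeMonoid

  -- The right side is the m-th power of `product t`, in the form in which `det-scale-columns`
  -- yields it for a constant factor.
  product-^ : ∀ {n} (t : Fin n → Carrier) m → product (λ i → t i ^ m) ≈ product {m} (λ _ → product t)
  product-^ {n} t zero    = Π.sum-replicate-zero n
  product-^ {n} t (suc m) = trans (Π.∑-distrib-+ {n} t (λ i → t i ^ m)) (*-congˡ {product t} (product-^ t m))

-- Products of linear factors, the Vandermonde determinant and the bialternant argument.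

module LinearFactors {c ℓ} (R : CommutativeRing c ℓ) where
  open RingNotation R
  open SetoidReasoning setoid
  open Solver commutativeSemiring using (solve; _:+_; _:*_; _:=_)
  open Determinant R
  private
    module Σ = Sum semiring
    module Π = CommutativeMonoidSum *-commutativeMonoid
  open Cancellation R
  open Products R

  -- The coefficient of Xˢ in ∏ᵢ (α i + γ i X).
  coeffs : ∀ {n} (α γ : Fin n → Carrier) → ℕ → Carrier
  coeffs {zero}  α γ zero    = 1#
  coeffs {zero}  α γ (suc s) = 0#
  coeffs {suc n} α γ zero    = α zero * coeffs (α ∘ suc) (γ ∘ suc) zero
  coeffs {suc n} α γ (suc s) = α zero * coeffs (α ∘ suc) (γ ∘ suc) (suc s) + γ zero * coeffs (α ∘ suc) (γ ∘ suc) s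

  -- The initial term of the sequence obtained from a by applying
  -- ∏ᵢ (α i + γ i S), where S is the shift.
  shifts : ∀ {n} (α γ : Fin n → Carrier) → (ℕ → Carrier) → Carrier
  shifts {zero}  α γ a = a 0
  shifts {suc n} α γ a = α zero * shifts (α ∘ suc) (γ ∘ suc) a + γ zero * shifts (α ∘ suc) (γ ∘ suc) (a ∘ suc)

  -- `N` may exceed the degree because, of the two recursive sums over one factor less, the one with
  -- the unshifted sequence keeps the old upper limit.
  sum-coeffs : ∀ {n} (α γ : Fin n → Carrier) a {N} → n ≤ N →
               sum {suc N} (λ s → a (toℕ s) * coeffs α γ (toℕ s)) ≈ shifts α γ a
  sum-coeffs {zero} α γ a {N} _ = begin
    a 0 * 1# + sum {N} (λ s → a (suc (toℕ s)) * 0#)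
      ≈⟨ +-cong (*-identityʳ _) (sum-zero {N} _ λ s → zeroʳ (a (suc (toℕ s)))) ⟩
    a 0 + 0#
      ≈⟨ +-identityʳ _ ⟩
    a 0 ∎
  sum-coeffs {suc n} α γ a {suc N} (s≤s n≤N) = begin
    a 0 * (α₀ * k 0) + sum {suc N} (λ s → a (suc (toℕ s)) * (α₀ * k (suc (toℕ s)) + γ₀ * k (toℕ s)))
      ≈⟨ +-congˡ (Σ.sum-cong-≋ {suc N} λ s →
           solve 5 (λ a α γ k k′ → a :* (α :* k :+ γ :* k′) := α :* (a :* k) :+ γ :* (a :* k′)) refl
             (a (suc (toℕ s))) α₀ γ₀ (k (suc (toℕ s))) (k (toℕ s))) ⟩
    a 0 * (α₀ * k 0) + sum {suc N} (λ s → α₀ * (a (suc (toℕ s)) * k (suc (toℕ s))) + γ₀ * (a (suc (toℕ s)) * k (toℕ s)))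
      ≈⟨ +-congˡ (sum-linear {suc N} α₀ γ₀ (λ s → a (suc (toℕ s)) * k (suc (toℕ s))) (λ s → a (suc (toℕ s)) * k (toℕ s))) ⟩
    a 0 * (α₀ * k 0) + (α₀ * u + γ₀ * v)
      ≈⟨ solve 6 (λ a α k u γ v → a :* (α :* k) :+ (α :* u :+ γ :* v) := α :* (a :* k :+ u) :+ γ :* v) refl
           (a 0) α₀ (k 0) u γ₀ v ⟩
    α₀ * (a 0 * k 0 + u) + γ₀ * v
      ≈⟨ +-cong (*-congˡ {α₀} (sum-coeffs (α ∘ suc) (γ ∘ suc) a (ℕ.m≤n⇒m≤1+n n≤N)))
                (*-congˡ {γ₀} (sum-coeffs (α ∘ suc) (γ ∘ suc) (a ∘ suc) n≤N)) ⟩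
    α₀ * shifts (α ∘ suc) (γ ∘ suc) a + γ₀ * shifts (α ∘ suc) (γ ∘ suc) (a ∘ suc) ∎
    where
    α₀ = α zero
    γ₀ = γ zero
    k = coeffs (α ∘ suc) (γ ∘ suc)
    u = sum {suc N} (λ s → a (suc (toℕ s)) * k (suc (toℕ s)))
    v = sum {suc N} (λ s → a (suc (toℕ s)) * k (toℕ s))

  coeffs-degree : ∀ {n} (α γ : Fin n → Carrier) {s} → n < s → coeffs α γ s ≈ 0#
  coeffs-degree {zero}  α γ {suc s} _ = refl
  coeffs-degree {suc n} α γ {suc s} (s≤s n<s) = trans
    (+-cong (trans (*-congˡ {α zero} (coeffs-degree (α ∘ suc) (γ ∘ suc) (ℕ.m<n⇒m<1+n n<s))) (zeroʳ _))
            (trans (*-congˡ {γ zero} (coeffs-degree (α ∘ suc) (γ ∘ suc) n<s)) (zeroʳ _)))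
    (+-identityˡ 0#)

  -- On a geometric sequence of ratio y the shift is multiplication by y.
  shifts-geometric : ∀ {n} (α γ : Fin n → Carrier) y a → (∀ s → a (suc s) ≈ y * a s) →
                     shifts α γ a ≈ product (λ i → α i + γ i * y) * a 0
  shifts-geometric {zero}  α γ y a eq = sym (*-identityˡ _)
  shifts-geometric {suc n} α γ y a eq = begin
    α zero * shifts (α ∘ suc) (γ ∘ suc) a + γ zero * shifts (α ∘ suc) (γ ∘ suc) (a ∘ suc)
      ≈⟨ +-cong (*-congˡ {α zero} (shifts-geometric (α ∘ suc) (γ ∘ suc) y a eq))
                (*-congˡ {γ zero} (trans (shifts-geometric (α ∘ suc) (γ ∘ suc) y (a ∘ suc) (eq ∘ suc)) (*-congˡ {P} (eq 0)))) ⟩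
    α zero * (P * a 0) + γ zero * (P * (y * a 0))
      ≈⟨ solve 5 (λ α γ P a y → α :* (P :* a) :+ γ :* (P :* (y :* a)) := (α :+ γ :* y) :* P :* a) refl
           (α zero) (γ zero) P (a 0) y ⟩
    (α zero + γ zero * y) * P * a 0 ∎
    where
    P = product (λ i → α (suc i) + γ (suc i) * y)

  -- The formula of `vandermonde` for arbitrary ring elements, so that induction can drop the first
  -- of them. For the variables the two agree by definition.
  vandermondeProduct : ∀ {n} → (Fin n → Carrier) → Carrier
  vandermondeProduct {n} x = product {n} λ j → product {toℕ j} λ i → x (inject {i = j} i) - x j

  vandermondeProduct-suc : ∀ {n} (x : Fin (suc n) → Carrier) →
    vandermondeProduct x ≈ product (λ j → x zero - x (suc j)) * vandermondeProduct (x ∘ suc)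
  vandermondeProduct-suc {n} x = trans (*-identityˡ _)
    (Π.∑-distrib-+ {n} (λ j → x zero - x (suc j))
      (λ j → product {toℕ j} λ i → x (suc (inject {i = j} i)) - x (suc j)))

  -- Column p holds the coefficients of ∏_{i ≠ p} (X - x i).
  nodal : ∀ {n} → (Fin (suc n) → Carrier) → Matrix (suc n) (suc n)
  nodal x j p = coeffs (λ i → - x (punchIn p i)) (λ _ → 1#) (toℕ j)

  -- Row 0 evaluates a polynomial at y, and row j + 1 extracts the coefficient
  -- of Xʲ in its quotient by X - y.
  horner : ∀ {n} → Carrier → Matrix n n
  horner y zero    k       = y ^ toℕ k
  horner y (suc j) zero    = 0#
  horner y (suc j) (suc k) = horner y j k

  det-horner : ∀ {n} y → det (horner {n} y) ≈ 1#
  det-horner {n} y = det-upper-unitriangular (horner {n} y) below diagonal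
    where
    below : ∀ {n} (i j : Fin n) → j Fin.< i → horner y i j ≈ 0#
    below (suc i) zero    _         = refl
    below (suc i) (suc j) (s≤s j<i) = below i j j<i
    diagonal : ∀ {n} (i : Fin n) → horner y i i ≈ 1#
    diagonal zero    = refl
    diagonal (suc i) = diagonal i

  telescope : ∀ {n} y (a : ℕ → Carrier) → a n ≈ 0# →
              sum {n} (λ k → y ^ toℕ k * (- y * a (suc (toℕ k)) + a (toℕ k))) ≈ a 0
  telescope {zero}  y a eq = sym eq
  telescope {suc n} y a eq = begin
    1# * (- y * a 1 + a 0) + sum {n} (λ k → y * y ^ toℕ k * (- y * a (suc (suc (toℕ k))) + a (suc (toℕ k))))
      ≈⟨ +-cong (*-identityˡ _) (trans (Σ.sum-cong-≋ {n} λ k → *-assoc y _ _)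
           (sym (Σ.*-distribˡ-sum {n} y λ k → y ^ toℕ k * (- y * a (suc (suc (toℕ k))) + a (suc (toℕ k)))))) ⟩
    (- y * a 1 + a 0) + y * sum {n} (λ k → y ^ toℕ k * (- y * a (suc (suc (toℕ k))) + a (suc (toℕ k))))
      ≈⟨ +-congˡ (*-congˡ {y} (telescope {n} y (a ∘ suc) eq)) ⟩
    (- y * a 1 + a 0) + y * a 1
      ≈⟨ solve 4 (λ m y b a → (m :* b :+ a) :+ y :* b := (m :+ y) :* b :+ a) refl (- y) y (a 1) (a 0) ⟩
    (- y + y) * a 1 + a 0
      ≈⟨ +-congʳ (trans (*-congʳ (-‿inverseˡ y)) (zeroˡ _)) ⟩
    0# + a 0
      ≈⟨ +-identityˡ _ ⟩
    a 0 ∎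

  -- The bracket is the coefficient of X^(k+1) in (X - y) ∑ₛ a s Xˢ, and the rows of `horner` undo
  -- the multiplication by X - y. Each sum telescopes to its first term because the last one
  -- contains `a n`, which is 0.
  horner-divides : ∀ {n} y (a : ℕ → Carrier) → a n ≈ 0# → (j : Fin n) →
                   sum {n} (λ k → horner y j k * (- y * a (suc (toℕ k)) + a (toℕ k))) ≈ a (toℕ j)
  horner-divides {suc n} y a eq zero    = telescope {suc n} y a eq
  horner-divides {suc n} y a eq (suc j) = trans
    (+-cong (zeroˡ _) (horner-divides {n} y (a ∘ suc) eq j)) (+-identityˡ _)

  -- Multiplication by the unitriangular `horner (x zero)` turns row 0 into values at `x zero`. All
  -- columns but the first have that root, so row 0 collapses to one entry; in the rows below,
  -- division by X - `x zero` leaves the nodal matrix of the other elements.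
  det-nodal : ∀ {n} (x : Fin (suc n) → Carrier) → det (nodal x) ≈ vandermondeProduct x
  det-nodal {zero} x = trans (+-identityʳ _) (*-congˡ {1#} (*-identityˡ 1#))
  det-nodal {suc n} x = begin
    det (nodal x)
      ≈⟨ *-identityˡ _ ⟨
    1# * det (nodal x)
      ≈⟨ *-congʳ (det-horner {suc (suc n)} (x zero)) ⟨
    det (horner {suc (suc n)} (x zero)) * det (nodal x)
      ≈⟨ det-⊗ (horner (x zero)) (nodal x) ⟨
    det N
      ≈⟨ det-lower-block N (λ p → trans (first-row (suc p)) (root≈0 p)) ⟩
    N zero zero * det (λ j p → N (suc j) (suc p))
      ≈⟨ *-cong (trans (first-row zero) (Π.sum-cong-≋ {suc n} λ i → +-comm (- x (suc i)) (x zero))) (trans (det-cong lower-rows) (det-nodal (x ∘ suc))) ⟩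
    product (λ i → x zero - x (suc i)) * vandermondeProduct (x ∘ suc)
      ≈⟨ vandermondeProduct-suc x ⟨
    vandermondeProduct x ∎
    where
    N : Matrix (suc (suc n)) (suc (suc n))
    N = horner (x zero) ⊗ nodal x

    first-row : ∀ p → N zero p ≈ product (λ i → - x (punchIn p i) + x zero)
    first-row p = trans (sum-coeffs (λ i → - x (punchIn p i)) (λ _ → 1#) (λ s → x zero ^ s) ℕ.≤-refl)
      (trans (shifts-geometric (λ i → - x (punchIn p i)) (λ _ → 1#) (x zero) (λ s → x zero ^ s) (λ s → refl))
        (trans (*-identityʳ _) (Π.sum-cong-≋ {suc n} λ i → +-congˡ { - x (punchIn p i)} (*-identityˡ (x zero)))))

    root≈0 : ∀ p → product (λ i → - x (punchIn (suc p) i) + x zero) ≈ 0#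
    root≈0 p = trans (*-congʳ (-‿inverseˡ (x zero))) (zeroˡ _)

    lower-rows : ∀ j p → N (suc j) (suc p) ≈ nodal (x ∘ suc) j p
    lower-rows j p = begin
      0# * nodal x zero (suc p) + sum {suc n} (λ k → horner (x zero) j k * (- x zero * a (suc (toℕ k)) + 1# * a (toℕ k)))
        ≈⟨ +-cong (zeroˡ _) (Σ.sum-cong-≋ {suc n} λ k → *-congˡ {horner (x zero) j k} (+-congˡ { - x zero * a (suc (toℕ k))} (*-identityˡ (a (toℕ k))))) ⟩
      0# + sum {suc n} (λ k → horner (x zero) j k * (- x zero * a (suc (toℕ k)) + a (toℕ k)))
        ≈⟨ trans (+-identityˡ _) (horner-divides {suc n} (x zero) a (coeffs-degree α (λ _ → 1#) ℕ.≤-refl) j) ⟩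
      a (toℕ j) ∎
      where
      α : Fin n → Carrier
      α i = - x (suc (punchIn p i))
      a = coeffs α (λ _ → 1#)

  det-scale-columns : ∀ {n} (a : Fin n → Carrier) (M : Matrix n n) →
                      det (λ i j → a j * M i j) ≈ product a * det M
  det-scale-columns {zero}  a M = sym (*-identityˡ 1#)
  det-scale-columns {suc n} a M = trans
    (Σ.sum-cong-≋ {suc n} λ j → begin
      (- 1#) ^ toℕ j * (a j * M zero j * det (λ i k → a (punchIn j k) * M (suc i) (punchIn j k)))
        ≈⟨ *-congˡ {(- 1#) ^ toℕ j} (*-congˡ {a j * M zero j} (det-scale-columns (a ∘ punchIn j) (λ i k → M (suc i) (punchIn j k)))) ⟩
      (- 1#) ^ toℕ j * (a j * M zero j * (product (a ∘ punchIn j) * minor M j))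
        ≈⟨ solve 5 (λ s a m p d → s :* (a :* m :* (p :* d)) := a :* p :* (s :* (m :* d))) refl
             ((- 1#) ^ toℕ j) (a j) (M zero j) (product (a ∘ punchIn j)) (minor M j) ⟩
      a j * product (a ∘ punchIn j) * term M j
        ≈⟨ *-congʳ (Π.sum-remove {n} {j} a) ⟨
      product a * term M j ∎)
    (sym (Σ.*-distribˡ-sum {suc n} (product a) (term M)))

  -- Column p is scaled by `w p ^ suc n` on one side and each of the n + 1 columns by `product w` on
  -- the other. The total factors are equal, hence they cancel.
  bialternant : ∀ {n} (x w : Fin (suc n) → Carrier) → (∀ p → Cancellable (w p)) →
                (A B : Matrix (suc n) (suc n)) →
                (∀ i p → w p ^ suc n * (A ⊗ nodal x) i p ≈ product w * B i p) →
                vandermondeProduct x * det A ≈ det B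
  bialternant {n} x w cancel A B eq = cancellable-cong (sym (product-^ w (suc n)))
    (cancellable-product {suc n} (λ _ → product w) λ _ → cancellable-product w cancel)
    (begin
      product (λ p → w p ^ suc n) * (vandermondeProduct x * det A)
        ≈⟨ *-congˡ {product (λ p → w p ^ suc n)} (trans (*-comm _ _) (*-congˡ {det A} (sym (det-nodal x)))) ⟩
      product (λ p → w p ^ suc n) * (det A * det (nodal x))
        ≈⟨ *-congˡ {product (λ p → w p ^ suc n)} (det-⊗ A (nodal x)) ⟨
      product (λ p → w p ^ suc n) * det (A ⊗ nodal x)
        ≈⟨ det-scale-columns (λ p → w p ^ suc n) (A ⊗ nodal x) ⟨
      det (λ i p → w p ^ suc n * (A ⊗ nodal x) i p)
        ≈⟨ det-cong eq ⟩
      det (λ i p → product w * B i p)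
        ≈⟨ det-scale-columns (λ _ → product w) B ⟩
      product {suc n} (λ _ → product w) * det B
        ≈⟨ *-congʳ (product-^ w (suc n)) ⟨
      product (λ p → w p ^ suc n) * det B ∎)

  -- Multiplication by a unitriangular matrix whose column j holds the
  -- coefficients of Xʲ (1 + t X)^(n - 1 - j).
  module ColumnOperations (t : Carrier) where

    -- In the application `a r s` is E^(e + r)(m + s) and `t` is β.
    Pascal : (ℕ → ℕ → Carrier) → Set ℓ
    Pascal a = ∀ r s → a (suc r) s ≈ a r s + t * a r (suc s)

    transition : ∀ {n} → Matrix n n
    transition {suc n} j       zero    = coeffs {n} (λ _ → 1#) (λ _ → t) (toℕ j)
    transition {suc n} zero    (suc k) = 0#
    transition {suc n} (suc j) (suc k) = transition j k

    det-transition : ∀ n → det (transition {n}) ≈ 1#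
    det-transition zero    = refl
    det-transition (suc n) = trans (det-lower-block (transition {suc n}) (λ j → refl))
      (trans (*-cong (constant-coeff n) (det-transition n)) (*-identityˡ 1#))
      where
      constant-coeff : ∀ n → coeffs {n} (λ _ → 1#) (λ _ → t) 0 ≈ 1#
      constant-coeff zero    = refl
      constant-coeff (suc n) = trans (*-identityˡ _) (constant-coeff n)

    -- By `Pascal` each application of 1 + t S raises r by one.
    shifts-Pascal : ∀ {a} → Pascal a → ∀ n → shifts {n} (λ _ → 1#) (λ _ → t) (a 0) ≈ a n 0
    shifts-Pascal {a} pascal zero    = refl
    shifts-Pascal {a} pascal (suc n) = trans
      (+-cong (trans (*-identityˡ _) (shifts-Pascal pascal n))
              (*-congˡ {t} (shifts-Pascal {λ r s → a r (suc s)} (λ r s → pascal r (suc s)) n)))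
      (sym (pascal n 0))

    sum-transition : ∀ {n a} → Pascal a → ∀ (j : Fin n) →
                     sum (λ k → a 0 (toℕ k) * transition k j) ≈ a (n ∸ suc (toℕ j)) (toℕ j)
    sum-transition {suc n} {a} pascal zero = trans
      (sum-coeffs {n} (λ _ → 1#) (λ _ → t) (a 0) ℕ.≤-refl) (shifts-Pascal pascal n)
    sum-transition {suc n} {a} pascal (suc j) = trans
      (+-cong (zeroʳ _) (sum-transition {n} {λ r s → a r (suc s)} (λ r s → pascal r (suc s)) j))
      (+-identityˡ _)

    det-column-operations : ∀ {n} (a : Fin n → ℕ → ℕ → Carrier) → (∀ i → Pascal (a i)) →
      det (λ i j → a i 0 (toℕ j)) ≈ det (λ i j → a i (n ∸ suc (toℕ j)) (toℕ j))
    det-column-operations {n} a pascal = begin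
      det A                          ≈⟨ *-identityʳ _ ⟨
      det A * 1#                     ≈⟨ *-congˡ {det A} (det-transition n) ⟨
      det A * det (transition {n})   ≈⟨ det-⊗ A transition ⟨
      det (A ⊗ transition)           ≈⟨ det-cong (λ i j → sum-transition (pascal i) j) ⟩
      det (λ i j → a i (n ∸ suc (toℕ j)) (toℕ j)) ∎
      where
      A : Matrix n n
      A i j = a i 0 (toℕ j)

i+sucj≡suc[i+j] : ∀ i j → i ℤ.+ + suc j ≡ ℤ.suc (i ℤ.+ + j)
i+sucj≡suc[i+j] i j = ≡.trans (≡.sym (ℤ.+-assoc i (+ 1) (+ j)))
  (≡.trans (≡.cong (ℤ._+ + j) (ℤ.+-comm i (+ 1))) (ℤ.+-assoc (+ 1) i (+ j)))

i+sucj≡suci+j : ∀ i j → i ℤ.+ + suc j ≡ ℤ.suc i ℤ.+ + j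
i+sucj≡suci+j i j = ≡.trans (i+sucj≡suc[i+j] i j) (≡.sym (ℤ.+-assoc (+ 1) i (+ j)))

-- Coefficients of products of geometric series and linear factors, at integer indices.

module SeriesCoefficients {c ℓ} (R : CommutativeRing c ℓ) where
  open RingNotation R
  open SetoidReasoning setoid
  open Solver commutativeSemiring using (solve; _:+_; _:*_; _:=_; con)
  open Determinant R using (sum-zero)
  open LinearFactors R using (shifts)
  open PowerSeries R using (Series; C; X; geometric; _⊛_; _≋_; ⊛-cong; ⊛-identityˡ; ⊛-assoc)
  private
    module U = RingNotation (R ⟦X⟧)
    module Σ = Sum semiring

  C-*-coeff : ∀ a (f : Series) n → (C a ⊛ f) n ≈ a * f n
  C-*-coeff a f n = trans
    (+-congˡ (sum-zero {n} (λ i → 0# * f (n ∸ suc (toℕ i))) λ i → zeroˡ (f (n ∸ suc (toℕ i)))))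
    (+-identityʳ _)

  X-*-coeff : ∀ (f : Series) n → (X ⊛ f) (suc n) ≈ f n
  X-*-coeff f n = trans (+-cong (zeroˡ (f (suc n)))
      (trans (⊛-cong {λ n → X (suc n)} {C 1#} {f} {f} (λ { zero → refl ; (suc _) → refl }) (λ _ → refl) n) (⊛-identityˡ f n)))
    (+-identityˡ _)

  geometric-*-coeff : ∀ y (f : Series) n →
                      (geometric y ⊛ f) (suc n) ≈ y * (geometric y ⊛ f) n + f (suc n)
  geometric-*-coeff y f n = trans
    (+-cong (*-identityˡ _)
      (trans (Σ.sum-cong-≋ {suc n} λ i → *-assoc y (y ^ toℕ i) (f (n ∸ toℕ i)))
        (sym (Σ.*-distribˡ-sum {suc n} y λ i → y ^ toℕ i * f (n ∸ toℕ i)))))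
    (+-comm _ _)

  extend : Series → ℤ → Carrier
  extend f (+ n)    = f n
  extend f -[1+ _ ] = 0#

  extend-cong : ∀ {f g} → f ≋ g → ∀ m → extend f m ≈ extend g m
  extend-cong eq (+ n)    = eq n
  extend-cong eq -[1+ _ ] = refl

  -- Coefficient form of (1 - y X) · a / (1 - y X) = a. Negative indices are included because the
  -- index λᵢ - i at which a row starts can be negative; the step from -1 to 0 is where the series
  -- begins.
  extend-geometric : ∀ a y (f : Series) m →
    extend ((C a ⊛ geometric y) ⊛ f) (ℤ.suc m) ≈
    y * extend ((C a ⊛ geometric y) ⊛ f) m + a * extend f (ℤ.suc m)
  extend-geometric a y f (+ n) = begin
    ((C a ⊛ geometric y) ⊛ f) (suc n)
      ≈⟨ ⊛-assoc (C a) (geometric y) f (suc n) ⟩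
    (C a ⊛ (geometric y ⊛ f)) (suc n)
      ≈⟨ C-*-coeff a (geometric y ⊛ f) (suc n) ⟩
    a * (geometric y ⊛ f) (suc n)
      ≈⟨ *-congˡ {a} (geometric-*-coeff y f n) ⟩
    a * (y * (geometric y ⊛ f) n + f (suc n))
      ≈⟨ solve 4 (λ a y g f → a :* (y :* g :+ f) := y :* (a :* g) :+ a :* f) refl a y ((geometric y ⊛ f) n) (f (suc n)) ⟩
    y * (a * (geometric y ⊛ f) n) + a * f (suc n)
      ≈⟨ +-congʳ (*-congˡ {y} (trans (⊛-assoc (C a) (geometric y) f n) (C-*-coeff a (geometric y ⊛ f) n))) ⟨
    y * ((C a ⊛ geometric y) ⊛ f) n + a * f (suc n) ∎
  extend-geometric a y f -[1+ zero ] = begin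
    (a * 1# + 0#) * f 0 + 0#
      ≈⟨ solve 2 (λ a f → (a :* con 1 :+ con 0) :* f :+ con 0 := a :* f) refl a (f 0) ⟩
    a * f 0
      ≈⟨ trans (+-congʳ (zeroʳ y)) (+-identityˡ _) ⟨
    y * 0# + a * f 0 ∎
  extend-geometric a y f -[1+ suc n ] = sym (trans (+-cong (zeroʳ y) (zeroʳ a)) (+-identityˡ 0#))

  shifts-cong : ∀ {n} (α γ : Fin n → Carrier) {a a′ : ℕ → Carrier} → (∀ s → a s ≈ a′ s) →
                shifts α γ a ≈ shifts α γ a′
  shifts-cong {zero}  α γ eq = eq 0
  shifts-cong {suc n} α γ eq = +-cong (*-congˡ {α zero} (shifts-cong (α ∘ suc) (γ ∘ suc) eq))
                                      (*-congˡ {γ zero} (shifts-cong (α ∘ suc) (γ ∘ suc) (eq ∘ suc)))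

  -- Applying S - y cancels a factor 1 / (1 - y X).
  shifts-geometric-product : ∀ {n} (a y : Fin n → Carrier) f m →
    shifts (λ i → - y i) (λ _ → 1#) (λ s → extend (U.product (λ i → C (a i) U.* geometric (y i)) U.* f) (m ℤ.+ + s)) ≈
    product a * extend f (m ℤ.+ + n)
  shifts-geometric-product {zero} a y f m = trans
    (extend-cong (⊛-identityˡ f) (m ℤ.+ + 0)) (sym (*-identityˡ _))
  shifts-geometric-product {suc n} a y f m = begin
    - y₀ * shifts α γ (λ s → extend (P U.* f) (m ℤ.+ + s)) + 1# * shifts α γ (λ s → extend (P U.* f) (m ℤ.+ + suc s))
      ≈⟨ +-cong (*-congˡ { - y₀} (shifts-cong α γ λ s → move (m ℤ.+ + s)))
                (*-congˡ {1#} (shifts-cong α γ λ s → trans (move (m ℤ.+ + suc s))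
                  (reflexive (≡.cong (extend (P′ U.* g)) (i+sucj≡suci+j m s))))) ⟩
    - y₀ * shifts α γ (λ s → extend (P′ U.* g) (m ℤ.+ + s)) + 1# * shifts α γ (λ s → extend (P′ U.* g) (ℤ.suc m ℤ.+ + s))
      ≈⟨ +-cong (*-congˡ { - y₀} (shifts-geometric-product (a ∘ suc) (y ∘ suc) g m))
                (trans (*-identityˡ _) (shifts-geometric-product (a ∘ suc) (y ∘ suc) g (ℤ.suc m))) ⟩
    - y₀ * (p * u) + p * extend g (ℤ.suc m ℤ.+ + n)
      ≈⟨ +-congˡ (*-congˡ {p} (trans (reflexive (≡.cong (extend g) (ℤ.+-assoc (+ 1) m (+ n))))
           (extend-geometric (a zero) y₀ f (m ℤ.+ + n)))) ⟩
    - y₀ * (p * u) + p * (y₀ * u + a zero * v)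
      ≈⟨ solve 6 (λ z p u y a v → z :* (p :* u) :+ p :* (y :* u :+ a :* v) := (z :+ y) :* (p :* u) :+ a :* p :* v) refl
           (- y₀) p u y₀ (a zero) v ⟩
    (- y₀ + y₀) * (p * u) + a zero * p * v
      ≈⟨ trans (+-congʳ (trans (*-congʳ (-‿inverseˡ y₀)) (zeroˡ _))) (+-identityˡ _) ⟩
    a zero * p * v
      ≈⟨ *-congˡ {a zero * p} (reflexive (≡.cong (extend f) (i+sucj≡suc[i+j] m n))) ⟨
    a zero * p * extend f (m ℤ.+ + suc n) ∎
    where
    y₀ = y zero
    α : Fin n → Carrier
    α i = - y (suc i)
    γ : Fin n → Carrier
    γ _ = 1#
    P = U.product (λ i → C (a i) U.* geometric (y i))
    P′ = U.product (λ i → C (a (suc i)) U.* geometric (y (suc i)))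
    g = (C (a zero) U.* geometric y₀) U.* f
    p = product (a ∘ suc)
    u = extend g (m ℤ.+ + n)
    v = extend f (ℤ.suc (m ℤ.+ + n))
    -- The first factor is absorbed into the remaining series, so the induction cancels the other
    -- factors first and `extend-geometric` then cancels this one.
    move : ∀ i → extend (P U.* f) i ≈ extend (P′ U.* g) i
    move = extend-cong (U.trans {P U.* f} {(P′ U.* (C (a zero) U.* geometric y₀)) U.* f} {P′ U.* g}
      (U.*-congʳ {f} {P} {P′ U.* (C (a zero) U.* geometric y₀)} (U.*-comm (C (a zero) U.* geometric y₀) P′))
      (U.*-assoc P′ (C (a zero) U.* geometric y₀) f))

  -- The factor 1 + (u + β) bⱼ of `F`, with `t` for β and `z` for bⱼ. At u = 1 / y it becomes, after
  -- multiplication by y, the sum y ⊕ bⱼ.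
  linearFactor : Carrier → Carrier → Series
  linearFactor t z = U.1# U.+ (X U.+ C t) U.* C z

  linearFactor-*-coeff : ∀ t z f n →
    (linearFactor t z U.* f) (suc n) ≈ f (suc n) + (z * f n + t * (z * f (suc n)))
  linearFactor-*-coeff t z f n = begin
    (linearFactor t z U.* f) (suc n)
      ≈⟨ U.distribʳ f U.1# ((X U.+ C t) U.* C z) (suc n) ⟩
    (U.1# U.* f) (suc n) + (((X U.+ C t) U.* C z) U.* f) (suc n)
      ≈⟨ +-cong (⊛-identityˡ f (suc n)) (U.*-assoc (X U.+ C t) (C z) f (suc n)) ⟩
    f (suc n) + ((X U.+ C t) U.* (C z U.* f)) (suc n)
      ≈⟨ +-congˡ (U.distribʳ (C z U.* f) X (C t) (suc n)) ⟩
    f (suc n) + ((X U.* (C z U.* f)) (suc n) + (C t U.* (C z U.* f)) (suc n))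
      ≈⟨ +-congˡ (+-cong (trans (X-*-coeff (C z U.* f) n) (C-*-coeff z f n))
           (trans (C-*-coeff t (C z U.* f) (suc n)) (*-congˡ {t} (C-*-coeff z f (suc n))))) ⟩
    f (suc n) + (z * f n + t * (z * f (suc n))) ∎

  -- A geometric series times a polynomial of degree k in X: beyond degree k
  -- the coefficients are those of the geometric series times the
  -- homogenised value of the polynomial.
  linearFactors-coeff : ∀ {k} t y (z : Fin k → Carrier) f → (∀ n → f (suc n) ≈ y * f n) → ∀ n →
    (U.product (λ j → linearFactor t (z j)) U.* f) (n ℕ.+ k) ≈
    product (λ j → y + z j + t * y * z j) * f n
  linearFactors-coeff {zero} t y z f eq n = trans (⊛-identityˡ f (n ℕ.+ 0))
    (trans (reflexive (≡.cong f (ℕ.+-identityʳ n))) (sym (*-identityˡ _)))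
  linearFactors-coeff {suc k} t y z f eq n = begin
    (P U.* f) (n ℕ.+ suc k)
      ≡⟨ ≡.cong (P U.* f) (ℕ.+-suc n k) ⟩
    (P U.* f) (suc (n ℕ.+ k))
      ≈⟨ U.*-assoc (linearFactor t z₀) P′ f (suc (n ℕ.+ k)) ⟩
    (linearFactor t z₀ U.* g) (suc (n ℕ.+ k))
      ≈⟨ linearFactor-*-coeff t z₀ g (n ℕ.+ k) ⟩
    g (suc n ℕ.+ k) + (z₀ * g (n ℕ.+ k) + t * (z₀ * g (suc n ℕ.+ k)))
      ≈⟨ +-cong next (+-cong (*-congˡ {z₀} (linearFactors-coeff t y (z ∘ suc) f eq n)) (*-congˡ {t} (*-congˡ {z₀} next))) ⟩
    p * (y * f n) + (z₀ * (p * f n) + t * (z₀ * (p * (y * f n))))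
      ≈⟨ solve 5 (λ p y f z t → p :* (y :* f) :+ (z :* (p :* f) :+ t :* (z :* (p :* (y :* f)))) := (y :+ z :+ t :* y :* z) :* p :* f) refl
           p y (f n) z₀ t ⟩
    (y + z₀ + t * y * z₀) * p * f n ∎
    where
    z₀ = z zero
    P = U.product (λ j → linearFactor t (z j))
    P′ = U.product (λ j → linearFactor t (z (suc j)))
    g = P′ U.* f
    p = product (λ j → y + z (suc j) + t * y * z (suc j))
    next : g (suc n ℕ.+ k) ≈ p * (y * f n)
    next = trans (linearFactors-coeff t y (z ∘ suc) f eq (suc n)) (*-congˡ {p} (eq n))

-- Pascal's rule for integer upper index.

module Binomials where
  open RingNotation (ℤ.+-*-commutativeRing ⟦X⟧)
  open SeriesCoefficients ℤ.+-*-commutativeRing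
  open PowerSeries ℤ.+-*-commutativeRing using (X; geometric; ⊛-identityˡ)

  [1+X]-*-coeff : ∀ f n → ((1# + X) * f) (suc n) ≡ f (suc n) ℤ.+ f n
  [1+X]-*-coeff f n = ≡.trans (distribʳ f 1# X (suc n)) (≡.cong₂ ℤ._+_ (⊛-identityˡ f (suc n)) (X-*-coeff f n))

  [1+X]-*-coeff₀ : ∀ f → ((1# + X) * f) 0 ≡ f 0
  [1+X]-*-coeff₀ f = ≡.trans (ℤ.+-identityʳ _) (ℤ.*-identityˡ (f 0))

  [1+X]*geometric : (1# + X) * geometric ℤ.-1ℤ ≈ 1#
  [1+X]*geometric zero    = ≡.refl
  [1+X]*geometric (suc n) = ≡.trans ([1+X]-*-coeff (geometric ℤ.-1ℤ) n)
    (≡.trans (≡.cong (ℤ._+ geometric ℤ.-1ℤ n) (ℤ.-1*i≡-i (geometric ℤ.-1ℤ n))) (ℤ.+-inverseˡ (geometric ℤ.-1ℤ n)))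

  [1+X]^-suc : ∀ e → [1+X]^ (ℤ.suc e) ≈ (1# + X) * ([1+X]^ e)
  [1+X]^-suc (+ n) = refl {(1# + X) ^ suc n}
  [1+X]^-suc -[1+ n ] = trans {[1+X]^ (ℤ.suc -[1+ n ])} {g^ n} {(1# + X) * (g * g^ n)} (shift n)
    (trans {g^ n} {1# * g^ n} {(1# + X) * (g * g^ n)} (sym {1# * g^ n} {g^ n} (*-identityˡ (g^ n)))
      (trans {1# * g^ n} {((1# + X) * g) * g^ n} {(1# + X) * (g * g^ n)}
        (*-congʳ {g^ n} {1#} {(1# + X) * g} (sym {(1# + X) * g} {1#} [1+X]*geometric)) (*-assoc (1# + X) g (g^ n))))
    where
    g = geometric ℤ.-1ℤ
    g^ : ℕ → Carrier
    g^ n = g ^ n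
    shift : ∀ n → [1+X]^ (ℤ.suc -[1+ n ]) ≈ g^ n
    shift zero    = refl {1#}
    shift (suc n) = refl {g^ (suc n)}

  binomial-Pascal : ∀ e s → binomial (ℤ.suc e) (suc s) ≡ binomial e (suc s) ℤ.+ binomial e s
  binomial-Pascal e s = ≡.trans ([1+X]^-suc e (suc s)) ([1+X]-*-coeff ([1+X]^ e) s)

  binomial-suc-0 : ∀ e → binomial (ℤ.suc e) 0 ≡ binomial e 0
  binomial-suc-0 e = ≡.trans ([1+X]^-suc e 0) ([1+X]-*-coeff₀ ([1+X]^ e))

-- Integer multiples in a commutative ring.

module IntegerMultiples {c ℓ} (R : CommutativeRing c ℓ) where
  open RingNotation R
  open SetoidReasoning setoid
  open RingProperties ring using (-‿+-comm; -0#≈0#; -‿distribʳ-*)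
  open Solver commutativeSemiring using (solve; _:+_; _:=_)
  private
    module × = Mult semiring

  ⊖-⋆ : ∀ m n a → (m ℤ.⊖ n) ⋆ a ≈ m × a - n × a
  ⊖-⋆ m       zero    a = sym (trans (+-congˡ -0#≈0#) (+-identityʳ _))
  ⊖-⋆ zero    (suc n) a = sym (+-identityˡ _)
  ⊖-⋆ (suc m) (suc n) a = begin
    (suc m ℤ.⊖ suc n) ⋆ a                    ≡⟨ ≡.cong (_⋆ a) (ℤ.[1+m]⊖[1+n]≡m⊖n m n) ⟩
    (m ℤ.⊖ n) ⋆ a                            ≈⟨ ⊖-⋆ m n a ⟩
    m × a - n × a                            ≈⟨ +-identityˡ _ ⟨
    0# + (m × a - n × a)                     ≈⟨ +-congʳ (-‿inverseʳ a) ⟨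
    (a - a) + (m × a - n × a)
      ≈⟨ solve 4 (λ a b m n → (a :+ b) :+ (m :+ n) := (a :+ m) :+ (b :+ n)) refl a (- a) (m × a) (- (n × a)) ⟩
    (a + m × a) + (- a + - (n × a))          ≈⟨ +-congˡ (-‿+-comm a (n × a)) ⟩
    suc m × a - suc n × a                    ∎

  ⋆-+ : ∀ y z a → (y ℤ.+ z) ⋆ a ≈ y ⋆ a + z ⋆ a
  ⋆-+ (+ m)    (+ n)    a = ×.×-homo-+ a m n
  ⋆-+ (+ m)    -[1+ n ] a = ⊖-⋆ m (suc n) a
  ⋆-+ -[1+ m ] (+ n)    a = trans (⊖-⋆ n (suc m) a) (+-comm _ _)
  ⋆-+ -[1+ m ] -[1+ n ] a = begin
    - (suc (suc (m ℕ.+ n)) × a)      ≡⟨ ≡.cong (λ k → - (suc k × a)) (ℕ.+-suc m n) ⟨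
    - (suc m ℕ.+ suc n) × a           ≈⟨ -‿cong (×.×-homo-+ a (suc m) (suc n)) ⟩
    - (suc m × a + suc n × a)        ≈⟨ -‿+-comm _ _ ⟨
    - (suc m × a) + - (suc n × a)    ∎

  ×-*ʳ : ∀ n a f → n × (a * f) ≈ a * n × f
  ×-*ʳ zero    a f = sym (zeroʳ a)
  ×-*ʳ (suc n) a f = trans (+-congˡ (×-*ʳ n a f)) (sym (distribˡ a f (n × f)))

  ⋆-*ʳ : ∀ z a f → z ⋆ (a * f) ≈ a * z ⋆ f
  ⋆-*ʳ (+ n)    a f = ×-*ʳ n a f
  ⋆-*ʳ -[1+ n ] a f = trans (-‿cong (×-*ʳ (suc n) a f)) (-‿distribʳ-* a _)

  ⋆-congˡ : ∀ z {f g} → f ≈ g → z ⋆ f ≈ z ⋆ g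
  ⋆-congˡ (+ n)    eq = ×.×-congʳ n eq
  ⋆-congˡ -[1+ n ] eq = -‿cong (×.×-congʳ (suc n) eq)

-- Convergence by order in the variables, and regular elements of the power series ring.

module Limits {c ℓ} (R : CommutativeRing c ℓ) where
  open MultiSeries R
  private
    module R = RingNotation R
    module S (d : ℕ) = RingNotation (R⟦x⟧ d)
    module Σ = Sum R.semiring

  order-resp : ∀ d {n f g} → S._≈_ d f g → Order d n f → Order d n g
  order-resp zero    eq o 0<n = R.trans (R.sym eq) (o 0<n)
  order-resp (suc d) eq o i   = order-resp d (eq i) (o i)

  order-separated : ∀ d f → (∀ n → Order d n f) → S._≈_ d f (S.0# d)
  order-separated zero    f o   = o 1 (s≤s z≤n)
  order-separated (suc d) f o i = order-separated d (f i) λ n →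
    -- The i-th coefficient of a series of order n is only known to have order n - i, so order n + i
    -- is requested of `f`.
    order-mono d (ℕ.≤-reflexive (≡.sym (ℕ.m+n∸n≡m n i))) (o (n ℕ.+ i) i)

  coeff-order : ∀ d {n} f → (∀ μ → Vec.sum μ < n → coeff d f μ R.≈ R.0#) → Order d n f
  coeff-order d f v = order-resp d (fromCoeff-coeff d f) (order-fromCoeff d (coeff d f) v)
    where
    fromCoeff-coeff : ∀ d f → S._≈_ d (fromCoeff d (coeff d f)) f
    fromCoeff-coeff zero    f   = R.refl
    fromCoeff-coeff (suc d) f i = fromCoeff-coeff d (f i)

  coeff-fromCoeff : ∀ d a μ → coeff d (fromCoeff d a) μ R.≈ a μ
  coeff-fromCoeff zero    a Vec.[]      = R.refl
  coeff-fromCoeff (suc d) a (m Vec.∷ μ) = coeff-fromCoeff d (λ μ → a (m Vec.∷ μ)) μ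

  coeff-0 : ∀ d μ → coeff d (S.0# d) μ R.≈ R.0#
  coeff-0 zero    Vec.[]      = R.refl
  coeff-0 (suc d) (m Vec.∷ μ) = coeff-0 d μ

  coeff-+ : ∀ d f g μ → coeff d (S._+_ d f g) μ R.≈ coeff d f μ R.+ coeff d g μ
  coeff-+ zero    f g Vec.[]      = R.refl
  coeff-+ (suc d) f g (m Vec.∷ μ) = coeff-+ d (f m) (g m) μ

  coeff-neg : ∀ d f μ → coeff d (S.-_ d f) μ R.≈ R.- coeff d f μ
  coeff-neg zero    f Vec.[]      = R.refl
  coeff-neg (suc d) f (m Vec.∷ μ) = coeff-neg d (f m) μ

  coeff-sum : ∀ d {N} (t : Fin N → S.Carrier d) μ → coeff d (S.sum d t) μ R.≈ R.sum (λ s → coeff d (t s) μ)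
  coeff-sum d {zero}  t μ = coeff-0 d μ
  coeff-sum d {suc N} t μ = R.trans (coeff-+ d (t zero) (S.sum d (t ∘ suc)) μ) (R.+-congˡ (coeff-sum d (t ∘ suc) μ))

  sum-truncate : ∀ {M N} (a : ℕ → R.Carrier) → (∀ s → M ≤ s → a s R.≈ R.0#) → M ≤ N →
                 R.sum {N} (λ s → a (toℕ s)) R.≈ R.sum {M} (λ s → a (toℕ s))
  sum-truncate {zero}  {N}     a v _         =
    R.trans (Σ.sum-cong-≋ {N} λ s → v (toℕ s) z≤n) (Σ.sum-replicate-zero N)
  sum-truncate {suc M} {suc N} a v (s≤s M≤N) =
    R.+-congˡ (sum-truncate (a ∘ suc) (λ s M≤s → v (suc s) (s≤s M≤s)) M≤N)

  -- `∑∞` is cut off at a bound that depends on the monomial, not at `N`. In degree below n the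
  -- terms between the two cutoffs vanish: by `vanishes` if `N` is the larger one, by the assumption
  -- on the tail otherwise.
  order-∑∞-tail : ∀ d {n N a} (a-summable : Summable d a) → (∀ s → N ≤ s → Order d n (a s)) →
                  Order d n (S._-_ d (∑∞ d a a-summable) (S.sum d {N} λ s → a (toℕ s)))
  order-∑∞-tail d {n} {N} {a} a-summable o = coeff-order d _ λ μ lt → R.trans
    (R.trans (coeff-+ d _ _ μ) (R.+-cong (coeff-fromCoeff d _ μ)
      (R.trans (coeff-neg d _ μ) (R.-‿cong (coeff-sum d {N} (λ s → a (toℕ s)) μ)))))
    (R.trans (R.+-congʳ (same-sum μ lt)) (R.-‿inverseʳ _))
    where
    open Summable a-summable
    same-sum : ∀ μ → Vec.sum μ < n → R.sum {bound μ} (λ s → coeff d (a (toℕ s)) μ) R.≈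
                                      R.sum {N} (λ s → coeff d (a (toℕ s)) μ)
    same-sum μ lt with ℕ.≤-total (bound μ) N
    ... | inj₁ le = R.sym (sum-truncate (λ s → coeff d (a s) μ) (vanishes μ) le)
    ... | inj₂ le = sum-truncate (λ s → coeff d (a s) μ) (λ s N≤s → order-coeff d (o s N≤s) μ lt) le

  module _ (d : ℕ) where
    open RingNotation (R⟦x⟧ d)
    open SetoidReasoning setoid
    open RingProperties ring using (-‿+-comm; -‿distribʳ-*)
    open Solver commutativeSemiring using (solve; _:+_; _:*_; _:=_)
    open Cancellation (R⟦x⟧ d)

    -- Convergence to 0 in the adic topology of the ideal generated by the variables. Through it
    -- identities between infinite sums reduce to identities between partial sums.
    Null : (ℕ → Carrier) → Set ℓ
    Null a = ∀ n → ∃[ N ] (∀ s → N ≤ s → Order d n (a s))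

    Limit : (ℕ → Carrier) → Carrier → Set ℓ
    Limit a f = Null (λ s → f - a s)

    null-resp : ∀ {a a′} → (∀ s → a s ≈ a′ s) → Null a → Null a′
    null-resp eq null n = let N , o = null n in N , λ s N≤s → order-resp d (eq s) (o s N≤s)

    null-+ : ∀ {a a′} → Null a → Null a′ → Null (λ s → a s + a′ s)
    null-+ null null′ n = let N , o = null n; N′ , o′ = null′ n in N ℕ.⊔ N′ , λ s le →
      order-+ d (o s (ℕ.≤-trans (ℕ.m≤m⊔n N N′) le)) (o′ s (ℕ.≤-trans (ℕ.m≤n⊔m N N′) le))

    null-*ˡ : ∀ {a} f → Null a → Null (λ s → f * a s)
    null-*ˡ f null n = let N , o = null n in N , λ s le → order-*ˡ d f (o s le)

    null-*ʳ : ∀ {a} f → Null a → Null (λ s → a s * f)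
    null-*ʳ f null = null-resp (λ s → *-comm f _) (null-*ˡ f null)

    null-neg : ∀ {a} → Null a → Null (λ s → - a s)
    null-neg null n = let N , o = null n in N , λ s le → order-neg d (o s le)

    null-0 : Null (λ _ → 0#)
    null-0 n = 0 , λ _ _ → order-0 d n

    null-suc : ∀ {a} → Null a → Null (a ∘ suc)
    null-suc null n = let N , o = null n in N , λ s le → o (suc s) (ℕ.m≤n⇒m≤1+n le)

    null-sum : ∀ {k} (a : Fin k → ℕ → Carrier) → (∀ i → Null (a i)) → Null (λ s → sum (λ i → a i s))
    null-sum {zero}  a null = null-0
    null-sum {suc k} a null = null-+ (null zero) (null-sum (a ∘ suc) (null ∘ suc))

    limit-unique : ∀ {a f g} → Limit a f → Limit a g → f ≈ g
    limit-unique {a} {f} {g} lf lg = begin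
      f             ≈⟨ +-identityʳ f ⟨
      f + 0#        ≈⟨ +-congˡ (-‿inverseˡ g) ⟨
      f + (- g + g) ≈⟨ +-assoc f (- g) g ⟨
      f - g + g     ≈⟨ +-congʳ (order-separated d (f - g) λ n →
                         let N , o = null-resp difference (null-+ lf (null-neg lg)) n in o N ℕ.≤-refl) ⟩
      0# + g        ≈⟨ +-identityˡ g ⟩
      g             ∎
      where
      difference : ∀ s → (f - a s) + - (g - a s) ≈ f - g
      difference s = begin
        (f - a s) + - (g - a s)           ≈⟨ +-congˡ (-‿+-comm g (- a s)) ⟨
        (f - a s) + (- g + - - a s)
          ≈⟨ solve 4 (λ f a g b → (f :+ a) :+ (g :+ b) := (f :+ g) :+ (a :+ b)) refl f (- a s) (- g) (- - a s) ⟩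
        (f - g) + (- a s + - - a s)       ≈⟨ +-congˡ (-‿inverseʳ (- a s)) ⟩
        (f - g) + 0#                      ≈⟨ +-identityʳ _ ⟩
        f - g                             ∎

    limit-cong : ∀ {a a′ f} → (∀ s → a s ≈ a′ s) → Limit a f → Limit a′ f
    limit-cong eq = null-resp λ s → +-congˡ (-‿cong (eq s))

    limit-const : ∀ f → Limit (λ _ → f) f
    limit-const f = null-resp (λ _ → sym (-‿inverseʳ f)) null-0

    limit-suc : ∀ {a f} → Limit a f → Limit (a ∘ suc) f
    limit-suc = null-suc

    limit-+ : ∀ {a a′ f f′} → Limit a f → Limit a′ f′ → Limit (λ s → a s + a′ s) (f + f′)
    limit-+ {a} {a′} {f} {f′} l l′ = null-resp (λ s → begin
      (f - a s) + (f′ - a′ s)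
        ≈⟨ solve 4 (λ f a g b → (f :+ a) :+ (g :+ b) := (f :+ g) :+ (a :+ b)) refl f (- a s) f′ (- a′ s) ⟩
      (f + f′) + (- a s + - a′ s)  ≈⟨ +-congˡ (-‿+-comm (a s) (a′ s)) ⟩
      (f + f′) - (a s + a′ s)      ∎) (null-+ l l′)

    limit-*ˡ : ∀ {a f} t → Limit a f → Limit (λ s → t * a s) (t * f)
    limit-*ˡ {a} {f} t l = null-resp (λ s → begin
      t * (f - a s)          ≈⟨ distribˡ t f (- a s) ⟩
      t * f + t * - a s      ≈⟨ +-congˡ (-‿distribʳ-* t (a s)) ⟨
      t * f - t * a s        ∎) (null-*ˡ t l)

    limit-∑∞ : ∀ {a} (a-summable : Summable d a) → Null a →
               Limit (λ N → sum {N} λ s → a (toℕ s)) (∑∞ d a a-summable)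
    limit-∑∞ a-summable null n = let N , o = null n in N , λ M N≤M →
      order-∑∞-tail d {n} {M} a-summable λ s M≤s → o s (ℕ.≤-trans N≤M M≤s)

    -- A null sequence a with a n + t a (n + 1) = 0 has
    -- a n = ± tˢ a (n + s) for every s.
    null-recurrence : ∀ t {a} → Null a → (∀ n → a n + t * a (suc n) ≈ 0#) → ∀ n → a n ≈ 0#
    null-recurrence t {a} null eq n = order-separated d (a n) λ k →
      let N , o = null k in descend k N n (o (n ℕ.+ N) (ℕ.m≤n+m N n))
      where
      descend : ∀ k N n → Order d k (a (n ℕ.+ N)) → Order d k (a n)
      descend k zero    n o = ≡.subst (λ m → Order d k (a m)) (ℕ.+-identityʳ n) o
      descend k (suc N) n o = order-resp d
        (begin
          - (t * a (suc n))                        ≈⟨ +-identityˡ _ ⟨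
          0# + - (t * a (suc n))                   ≈⟨ +-congʳ (eq n) ⟨
          a n + t * a (suc n) + - (t * a (suc n))  ≈⟨ +-assoc _ _ _ ⟩
          a n + (t * a (suc n) - t * a (suc n))    ≈⟨ +-congˡ (-‿inverseʳ _) ⟩
          a n + 0#                                 ≈⟨ +-identityʳ _ ⟩
          a n                                      ∎)
        (order-neg d (order-*ˡ d t (descend k N (suc n) (≡.subst (λ m → Order d k (a m)) (ℕ.+-suc n N) o))))

    null-recurrence-unique : ∀ t {a a′} → Null a → Null a′ →
                             (∀ n → a n + t * a (suc n) ≈ a′ n + t * a′ (suc n)) → ∀ n → a n ≈ a′ n
    null-recurrence-unique t {a} {a′} null null′ eq n = begin
      a n                    ≈⟨ +-identityʳ _ ⟨
      a n + 0#               ≈⟨ +-congˡ (-‿inverseˡ (a′ n)) ⟨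
      a n + (- a′ n + a′ n)  ≈⟨ +-assoc _ _ _ ⟨
      a n - a′ n + a′ n
        ≈⟨ +-congʳ (null-recurrence t {λ n → a n - a′ n} (null-+ null (null-neg null′)) homogeneous n) ⟩
      0# + a′ n              ≈⟨ +-identityˡ _ ⟩
      a′ n                   ∎
      where
      homogeneous : ∀ n → (a n - a′ n) + t * (a (suc n) - a′ (suc n)) ≈ 0#
      homogeneous n = begin
        (a n - a′ n) + t * (a (suc n) - a′ (suc n))
          ≈⟨ solve 5 (λ a b t c e → (a :+ b) :+ t :* (c :+ e) := (a :+ t :* c) :+ (b :+ t :* e)) refl
               (a n) (- a′ n) t (a (suc n)) (- a′ (suc n)) ⟩
        (a n + t * a (suc n)) + (- a′ n + t * - a′ (suc n))
          ≈⟨ +-cong (eq n) (trans (+-congˡ (sym (-‿distribʳ-* t _))) (-‿+-comm _ _)) ⟩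
        (a′ n + t * a′ (suc n)) - (a′ n + t * a′ (suc n))
          ≈⟨ -‿inverseʳ _ ⟩
        0# ∎

    -- If (1 + g) f = 0 then f = - g f, so order at least n for f implies order at least n + 1.
    cancellable-1+ : ∀ {g} → Order d 1 g → Cancellable (1# + g)
    cancellable-1+ {g} o = cancellable λ f eq → order-separated d f (orders f (begin
      - (g * f)                       ≈⟨ +-identityˡ _ ⟨
      0# + - (g * f)                  ≈⟨ +-congʳ eq ⟨
      (1# + g) * f + - (g * f)        ≈⟨ +-congʳ (trans (distribʳ f 1# g) (+-congʳ (*-identityˡ f))) ⟩
      f + g * f + - (g * f)           ≈⟨ +-assoc _ _ _ ⟩
      f + (g * f - g * f)             ≈⟨ +-congˡ (-‿inverseʳ _) ⟩
      f + 0#                          ≈⟨ +-identityʳ _ ⟩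
      f                               ∎))
      where
      orders : ∀ f → - (g * f) ≈ f → ∀ n → Order d n f
      orders f eq zero    = order-any d f
      orders f eq (suc n) = order-resp d eq (order-neg d (order-* d 1 n o (orders f eq n)))

  var-regular : ∀ d i f → S._≈_ d (S._*_ d (var d i) f) (S.0# d) → S._≈_ d f (S.0# d)
  var-regular (suc d) zero    f eq n = S.trans d (S.sym d (X-*-coeff f n)) (eq (suc n))
    where open SeriesCoefficients (R⟦x⟧ d)
  var-regular (suc d) (suc i) f eq n = var-regular d i (f n)
    (S.trans d (S.sym d (C-*-coeff (var d i) f n)) (eq n))
    where open SeriesCoefficients (R⟦x⟧ d)

  -- If `i` is the outermost variable and v the other one, comparing coefficients gives v f₀ = 0 and
  -- v fₙ₊₁ = fₙ, so all fₙ vanish in turn because v is regular. Otherwise both variables are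
  -- constants for the outermost one and the claim descends to the coefficients.
  var-difference-regular : ∀ d {i j} → i Fin.< j → ∀ f →
    S._≈_ d (S._*_ d (S._-_ d (var d i) (var d j)) f) (S.0# d) → S._≈_ d f (S.0# d)
  var-difference-regular (suc d) {i} {suc j} i<j f eq = case i i<j expand
    where
    open SeriesCoefficients (R⟦x⟧ d)
    open PowerSeries (R⟦x⟧ d) using (C)
    open RingNotation (R⟦x⟧ d)
    open SetoidReasoning setoid
    module U = RingNotation (R⟦x⟧ d ⟦X⟧)
    v = var d j

    expand : ∀ n → (var (suc d) i U.* f) n ≈ v * f n
    expand n = begin
      p                                          ≈⟨ +-identityʳ _ ⟨
      p + 0#                                     ≈⟨ +-congˡ (-‿inverseˡ q) ⟨
      p + (- q + q)                              ≈⟨ +-assoc _ _ _ ⟨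
      p - q + q                                  ≈⟨ +-congʳ (+-congˡ (RingProperties.-‿distribˡ-* U.ring (C v) f n)) ⟩
      p + ((U.- C v) U.* f) n + q                ≈⟨ +-congʳ (U.distribʳ f (var (suc d) i) (U.- C v) n) ⟨
      ((var (suc d) i U.- C v) U.* f) n + q      ≈⟨ +-congʳ (eq n) ⟩
      0# + q                                     ≈⟨ +-identityˡ _ ⟩
      q                                          ≈⟨ C-*-coeff v f n ⟩
      v * f n                                    ∎
      where
      p = (var (suc d) i U.* f) n
      q = (C v U.* f) n

    case : ∀ i → i Fin.< suc j → (∀ n → (var (suc d) i U.* f) n ≈ v * f n) → ∀ n → f n ≈ 0#
    case zero _ eq zero = var-regular d j (f 0)
      (trans (sym (eq 0)) (trans (+-identityʳ _) (zeroˡ _)))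
    case zero i<j eq (suc n) = var-regular d j (f (suc n))
      (trans (sym (eq (suc n))) (trans (X-*-coeff f n) (case zero i<j eq n)))
    case (suc i) (s≤s i<j) eq n = var-difference-regular d i<j (f n) (begin
      (var d i - v) * f n              ≈⟨ distribʳ (f n) (var d i) (- v) ⟩
      var d i * f n + - v * f n        ≈⟨ +-congˡ (RingProperties.-‿distribˡ-* ring v (f n)) ⟨
      var d i * f n - v * f n          ≈⟨ +-congʳ (trans (sym (C-*-coeff (var d i) f n)) (eq n)) ⟩
      v * f n - v * f n                ≈⟨ -‿inverseʳ _ ⟩
      0#                               ∎)

pos-∸ : ∀ {m n} → m ≤ n → + (n ∸ m) ≡ + n ℤ.- + m
pos-∸ {m} {n} m≤n = ≡.sym (≡.trans (ℤ.m-n≡m⊖n n m) (ℤ.⊖-≥ m≤n))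

m≤i+n : ∀ i m n → m ℕ.+ ∣ i ∣ ≤ n → + m ℤ.≤ i ℤ.+ + n
m≤i+n (+ a)    m n le = ℤ.+≤+ (ℕ.≤-trans (ℕ.m≤m+n m a) (ℕ.≤-trans le (ℕ.m≤n+m n a)))
m≤i+n -[1+ a ] m n le = ≡.subst (+ m ℤ.≤_)
  (≡.sym (ℤ.⊖-≥ (ℕ.≤-trans (ℕ.m≤n+m (suc a) m) le))) (ℤ.+≤+ (ℕ.m+n≤o⇒m≤o∸n m le))

-- Recurrences for the entries of the determinants.

module Entries (d : ℕ) where
  open MultiSeries ℤ[ Indeterminate ]
  open Limits ℤ[ Indeterminate ]
  open RingNotation (R⟦x⟧ d)
  open SetoidReasoning setoid
  open Solver commutativeSemiring using (solve; _:+_; _:*_; _:=_; con)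
  open FactorialGrothendieck d using
    (β′; F-coeff; F-coeff-order; Gm-term; Gm-summable; Gm; Gm-order; entry-term; entry-summable; entry)
  open Determinant (R⟦x⟧ d) using (x+-1*x≈0)
  open IntegerMultiples (R⟦x⟧ d)
  private
    module Σ = Sum semiring

  null-Gm-term : ∀ k m → Null d (Gm-term k m)
  null-Gm-term k m n = n ℕ.+ k ℕ.+ ∣ m ∣ , λ s le →
    order-*ˡ d ((- 1#) ^ s * β′ ^ s) (F-coeff-order k (m ℤ.+ + s) n (m≤i+n m (n ℕ.+ k) s le))

  -- Multiplication of the generating function by 1 + β u⁻¹ leaves `F k`. On partial sums: once its
  -- first term is removed, the sum for m is - β times the sum for m + 1.
  Gm-recurrence : ∀ k m → Gm k m + β′ * Gm k (ℤ.suc m) ≈ F-coeff k m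
  Gm-recurrence k m = begin
    Gm k m + β′ * g                       ≈⟨ +-congʳ peeled ⟩
    F-coeff k m + - 1# * β′ * g + β′ * g
      ≈⟨ solve 4 (λ f z b g → f :+ z :* b :* g :+ b :* g := f :+ (b :* g :+ z :* (b :* g))) refl (F-coeff k m) (- 1#) β′ g ⟩
    F-coeff k m + (β′ * g + - 1# * (β′ * g))
      ≈⟨ trans (+-congˡ (x+-1*x≈0 (β′ * g))) (+-identityʳ _) ⟩
    F-coeff k m ∎
    where
    g = Gm k (ℤ.suc m)
    peeled : Gm k m ≈ F-coeff k m + - 1# * β′ * g
    peeled = limit-unique d
      (limit-suc d (limit-∑∞ d (Gm-summable k m) (null-Gm-term k m)))
      (limit-cong d
        (λ N → sym (+-cong
          (trans (solve 1 (λ f → con 1 :* con 1 :* f := f) refl (F-coeff k (m ℤ.+ + 0)))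
            (reflexive (≡.cong (F-coeff k) (ℤ.+-identityʳ m))))
          (trans (Σ.sum-cong-≋ {N} λ s → trans
              (solve 5 (λ z b y c f → z :* y :* (b :* c) :* f := z :* b :* (y :* c :* f)) refl
                (- 1#) β′ ((- 1#) ^ toℕ s) (β′ ^ toℕ s) (F-coeff k (m ℤ.+ + suc (toℕ s))))
              (*-congˡ { - 1# * β′} (*-congˡ {(- 1#) ^ toℕ s * β′ ^ toℕ s}
                (reflexive (≡.cong (F-coeff k) (i+sucj≡suci+j m (toℕ s)))))))
            (sym (Σ.*-distribˡ-sum {N} (- 1# * β′) (λ s → Gm-term k (ℤ.suc m) (toℕ s)))))))
        (limit-+ d (limit-const d (F-coeff k m))
          (limit-*ˡ d (- 1# * β′) (limit-∑∞ d (Gm-summable k (ℤ.suc m)) (null-Gm-term k (ℤ.suc m))))))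

  null-entry-term : ∀ e k m → Null d (entry-term e k m)
  null-entry-term e k m n = n ℕ.+ k ℕ.+ ∣ m ∣ , λ s le →
    order-⋆ d (binomial e s) (order-*ˡ d (β′ ^ s) (Gm-order k (m ℤ.+ + s) n (m≤i+n m (n ℕ.+ k) s le)))

  limit-entry : ∀ e k m → Limit d (λ N → sum {N} λ s → entry-term e k m (toℕ s)) (entry e k m)
  limit-entry e k m = limit-∑∞ d (entry-summable e k m) (null-entry-term e k m)

  -- Pascal's rule on partial sums: N + 1 terms on the left match N + 1 terms of the first series
  -- and N terms of the second, whose index is one ahead.
  entry-Pascal : ∀ e k m → entry (ℤ.suc e) k m ≈ entry e k m + β′ * entry e k (ℤ.suc m)
  entry-Pascal e k m = limit-unique d
    (limit-suc d (limit-entry (ℤ.suc e) k m))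
    (limit-cong d (λ N → sym (begin
        entry-term (ℤ.suc e) k m 0 + sum {N} (λ s → entry-term (ℤ.suc e) k m (suc (toℕ s)))
          ≈⟨ +-cong (reflexive (≡.cong (_⋆ (1# * Gm k (m ℤ.+ + 0))) (Binomials.binomial-suc-0 e)))
                    (Σ.sum-cong-≋ {N} λ s → term (toℕ s)) ⟩
        entry-term e k m 0 + sum {N} (λ s → entry-term e k m (suc (toℕ s)) + β′ * entry-term e k (ℤ.suc m) (toℕ s))
          ≈⟨ +-congˡ (trans (Σ.∑-distrib-+ {N} (λ s → entry-term e k m (suc (toℕ s))) (λ s → β′ * entry-term e k (ℤ.suc m) (toℕ s)))
               (+-congˡ (sym (Σ.*-distribˡ-sum {N} β′ (λ s → entry-term e k (ℤ.suc m) (toℕ s)))))) ⟩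
        entry-term e k m 0 + (sum {N} (λ s → entry-term e k m (suc (toℕ s))) + β′ * sum {N} (λ s → entry-term e k (ℤ.suc m) (toℕ s)))
          ≈⟨ +-assoc _ _ _ ⟨
        sum {suc N} (λ s → entry-term e k m (toℕ s)) + β′ * sum {N} (λ s → entry-term e k (ℤ.suc m) (toℕ s)) ∎))
      (limit-+ d (limit-suc d (limit-entry e k m)) (limit-*ˡ d β′ (limit-entry e k (ℤ.suc m)))))
    where
    term : ∀ s → entry-term (ℤ.suc e) k m (suc s) ≈ entry-term e k m (suc s) + β′ * entry-term e k (ℤ.suc m) s
    term s = begin
      binomial (ℤ.suc e) (suc s) ⋆ h
        ≡⟨ ≡.cong (_⋆ h) (Binomials.binomial-Pascal e s) ⟩
      (binomial e (suc s) ℤ.+ binomial e s) ⋆ h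
        ≈⟨ ⋆-+ (binomial e (suc s)) (binomial e s) h ⟩
      binomial e (suc s) ⋆ h + binomial e s ⋆ h
        ≈⟨ +-congˡ (⋆-congˡ (binomial e s) (trans (*-assoc β′ (β′ ^ s) _)
             (*-congˡ {β′} (*-congˡ {β′ ^ s} (reflexive (≡.cong (Gm k) (i+sucj≡suci+j m s))))))) ⟩
      binomial e (suc s) ⋆ h + binomial e s ⋆ (β′ * (β′ ^ s * Gm k (ℤ.suc m ℤ.+ + s)))
        ≈⟨ +-congˡ (⋆-*ʳ (binomial e s) β′ (β′ ^ s * Gm k (ℤ.suc m ℤ.+ + s))) ⟩
      binomial e (suc s) ⋆ h + β′ * binomial e s ⋆ (β′ ^ s * Gm k (ℤ.suc m ℤ.+ + s)) ∎
      where
      h = β′ ^ suc s * Gm k (m ℤ.+ + suc s)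

  entry-0 : ∀ k m → entry (+ 0) k m ≈ Gm k m
  entry-0 k m = limit-unique d (limit-suc d (limit-entry (+ 0) k m))
    (limit-cong d (λ N → sym (begin
        (1# * Gm k (m ℤ.+ + 0) + 0#) + sum {N} (λ s → 0#)
          ≈⟨ +-cong (solve 1 (λ g → con 1 :* g :+ con 0 := g) refl (Gm k (m ℤ.+ + 0))) (Σ.sum-replicate-zero N) ⟩
        Gm k (m ℤ.+ + 0) + 0#
          ≈⟨ +-identityʳ _ ⟩
        Gm k (m ℤ.+ + 0)
          ≡⟨ ≡.cong (Gm k) (ℤ.+-identityʳ m) ⟩
        Gm k m ∎))
      (limit-const d (Gm k m)))

  entry-1 : ∀ k m → entry (+ 1) k m ≈ F-coeff k m
  entry-1 k m = trans (entry-Pascal (+ 0) k m)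
    (trans (+-cong (entry-0 k m) (*-congˡ {β′} (entry-0 k (ℤ.suc m)))) (Gm-recurrence k m))

  -- E^(r+1) is (1 + β S)^r applied to the coefficients of `F k`. This looks at most r indices
  -- ahead, from -(r + 1 + t) no further than -(1 + t), where these coefficients are still 0.
  entry-vanishes : ∀ r t k → entry (+ suc r) k -[1+ r ℕ.+ t ] ≈ 0#
  entry-vanishes zero    t k = entry-1 k -[1+ t ]
  entry-vanishes (suc r) t k = trans (entry-Pascal (+ suc r) k -[1+ suc r ℕ.+ t ])
    (trans (+-cong (trans (reflexive (≡.cong (λ n → entry (+ suc r) k -[1+ n ]) (≡.sym (ℕ.+-suc r t)))) (entry-vanishes r (suc t) k))
                   (trans (*-congˡ {β′} (entry-vanishes r t k)) (zeroʳ β′)))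
      (+-identityˡ 0#))

  null-entry : ∀ e k m → Null d (λ s → entry e k (m ℤ.+ + s))
  null-entry e k m n = n ℕ.+ k ℕ.+ ∣ m ∣ , λ s le →
    order-∑∞ d (entry-summable e k (m ℤ.+ + s)) λ t →
      order-⋆ d (binomial e t) (order-*ˡ d (β′ ^ t)
        (Gm-order k (m ℤ.+ + s ℤ.+ + t) n (ℤ.≤-trans (m≤i+n m (n ℕ.+ k) s le) (ℤ.i≤i+j (m ℤ.+ + s) (+ t)))))

-- Gₘ⁽ᵏ⁾ with m = 0 is the value at u = -β of the series F k.
module ConstantTerm (d : ℕ) where
  open MultiSeries ℤ[ Indeterminate ]
  open Limits ℤ[ Indeterminate ]
  open RingNotation (R⟦x⟧ d)
  open SetoidReasoning setoid
  open Solver commutativeSemiring using (solve; _:+_; _:*_; _:=_; con)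
  open FactorialGrothendieck d using (x; β′; b′; F; Gm; Gm-order)
  open PowerSeries (R⟦x⟧ d) using (Series; C; X; geometric; _≋_)
  open SeriesCoefficients (R⟦x⟧ d)
  open Entries d
  private
    module U = RingNotation (R⟦x⟧ d ⟦X⟧)
    module USolver = Solver U.commutativeSemiring

  u+β : Series
  u+β = X U.+ C β′

  u+β-*-coeff₀ : ∀ f → (u+β U.* f) 0 ≈ β′ * f 0
  u+β-*-coeff₀ f = solve 2 (λ b f → (con 0 :+ b) :* f :+ con 0 := b :* f) refl β′ (f 0)

  u+β-*-coeff : ∀ f n → (u+β U.* f) (suc n) ≈ f n + β′ * f (suc n)
  u+β-*-coeff f n = trans (U.distribʳ f X (C β′) (suc n)) (+-cong (X-*-coeff f n) (C-*-coeff β′ f (suc n)))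

  -- Value 1 at u = -β, expressed by divisibility of f - 1 by u + β, since the evaluation itself
  -- would be an infinite sum. The slope of the quotient makes its coefficients a null sequence.
  ValueOne : Series → Set
  ValueOne f = ∃[ q ] ∃[ k ] (Slope d k q Product.× f ≋ U.1# U.+ u+β U.* q)

  slope-mono : ∀ {k l f} → k ≤ l → Slope d k f → Slope d l f
  slope-mono k≤l s n = order-mono d (ℕ.∸-monoʳ-≤ n k≤l) (s n)

  valueOne-1 : ValueOne U.1#
  valueOne-1 = U.0# , 0 , (λ n → order-0 d (n ∸ 0)) ,
    USolver.solve 1 (λ v → USolver.con 1 USolver.:= USolver.con 1 USolver.:+ v USolver.:* USolver.con 0) (λ n → refl) u+β

  valueOne-* : ∀ {f g} → ValueOne f → ValueOne g → ValueOne (f U.* g)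
  valueOne-* {f} {g} (p , k , sp , f≈) (q , l , sq , g≈) =
    q U.+ p U.* (U.1# U.+ u+β U.* q) , l ℕ.+ (k ℕ.+ suc l) ,
    slope-+ d (l ℕ.+ (k ℕ.+ suc l)) {q} {p U.* (U.1# U.+ u+β U.* q)} (slope-mono {l} {l ℕ.+ (k ℕ.+ suc l)} {q} (ℕ.m≤m+n l (k ℕ.+ suc l)) sq)
      (slope-mono {k ℕ.+ suc l} {l ℕ.+ (k ℕ.+ suc l)} {p U.* (U.1# U.+ u+β U.* q)} (ℕ.m≤n+m (k ℕ.+ suc l) l)
        (slope-* d k (suc l) {p} {U.1# U.+ u+β U.* q} sp
          (slope-+ d (suc l) {U.1#} {u+β U.* q} (slope-C d (suc l) 1#)
            (slope-* d 1 l {u+β} {q} (slope-+ d 1 {X} {C β′} (slope-X d) (slope-C d 1 β′)) sq)))) ,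
    U.trans {f U.* g} {(U.1# U.+ u+β U.* p) U.* (U.1# U.+ u+β U.* q)} {U.1# U.+ u+β U.* (q U.+ p U.* (U.1# U.+ u+β U.* q))}
      (U.*-cong {f} {U.1# U.+ u+β U.* p} {g} {U.1# U.+ u+β U.* q} f≈ g≈)
      (USolver.solve 3 (λ v p q → (USolver.con 1 USolver.:+ v USolver.:* p) USolver.:* (USolver.con 1 USolver.:+ v USolver.:* q) USolver.:=
                            USolver.con 1 USolver.:+ v USolver.:* (q USolver.:+ p USolver.:* (USolver.con 1 USolver.:+ v USolver.:* q))) (λ n → refl) u+β p q)

  valueOne-product : ∀ {n} (t : Fin n → Series) → (∀ i → ValueOne (t i)) → ValueOne (U.product t)
  valueOne-product {zero}  t v = valueOne-1
  valueOne-product {suc n} t v = valueOne-* {t zero} {U.product (t ∘ suc)} (v zero) (valueOne-product (t ∘ suc) (v ∘ suc))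

  -- (1 + β x) / (1 - x u) = 1 + (u + β) · x / (1 - x u).
  valueOne-geometric : ∀ i → ValueOne (C (1# + β′ * x i) U.* geometric (x i))
  valueOne-geometric i = C (x i) U.* geometric (x i) , 0 ,
    slope-* d 0 0 {C (x i)} {geometric (x i)} (slope-C d 0 (x i)) (order-var^ d i) , coeffs≈
    where
    q = C (x i) U.* geometric (x i)
    q≈ : ∀ n → q n ≈ x i * x i ^ n
    q≈ n = C-*-coeff (x i) (geometric (x i)) n
    coeffs≈ : C (1# + β′ * x i) U.* geometric (x i) ≋ U.1# U.+ u+β U.* q
    coeffs≈ zero = begin
      (1# + β′ * x i) * 1# + 0#
        ≈⟨ solve 2 (λ b x → (con 1 :+ b :* x) :* con 1 :+ con 0 := con 1 :+ b :* (x :* con 1)) refl β′ (x i) ⟩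
      1# + β′ * (x i * 1#)
        ≈⟨ +-congˡ (trans (u+β-*-coeff₀ q) (*-congˡ {β′} (q≈ 0))) ⟨
      1# + (u+β U.* q) 0 ∎
    coeffs≈ (suc n) = begin
      (C (1# + β′ * x i) U.* geometric (x i)) (suc n)
        ≈⟨ C-*-coeff (1# + β′ * x i) (geometric (x i)) (suc n) ⟩
      (1# + β′ * x i) * (x i * x i ^ n)
        ≈⟨ solve 3 (λ b x y → (con 1 :+ b :* x) :* (x :* y) := con 0 :+ (x :* y :+ b :* (x :* (x :* y)))) refl β′ (x i) (x i ^ n) ⟩
      0# + (x i * x i ^ n + β′ * (x i * (x i * x i ^ n)))
        ≈⟨ +-congˡ (trans (u+β-*-coeff q n) (+-cong (q≈ n) (*-congˡ {β′} (q≈ (suc n))))) ⟨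
      0# + (u+β U.* q) (suc n) ∎

  valueOne-F : ∀ k → ValueOne (F k)
  valueOne-F k = valueOne-* {U.product (λ i → C (1# + β′ * x i) U.* geometric (x i))} {U.product {k} (λ j → U.1# U.+ u+β U.* C (b′ (toℕ j)))}
    (valueOne-product (λ i → C (1# + β′ * x i) U.* geometric (x i)) valueOne-geometric)
    (valueOne-product {k} (λ j → U.1# U.+ u+β U.* C (b′ (toℕ j))) λ j →
      C (b′ (toℕ j)) , 0 , slope-C d 0 (b′ (toℕ j)) , λ n → refl)

  -- With F = 1 + (u + β) q, the null sequence 1, q₀, q₁, ... satisfies the recurrence of
  -- `Gm-recurrence`, because F₀ = 1 + β q₀ and Fₙ₊₁ = qₙ + β qₙ₊₁. Hence it is the sequence of the
  -- `Gm k (+ n)`.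
  Gm-0 : ∀ k → Gm k (+ 0) ≈ 1#
  Gm-0 k = let q , l , slope , F≈ = valueOne-F k in
    null-recurrence-unique d β′ {λ n → Gm k (+ n)} {λ { zero → 1# ; (suc n) → q n }}
      (λ n → n ℕ.+ k , λ s le → Gm-order k (+ s) n (ℤ.+≤+ le))
      (λ n → suc (n ℕ.+ l) , λ { (suc s) (s≤s le) → order-mono d (ℕ.m+n≤o⇒m≤o∸n n le) (slope s) })
      (λ { zero    → trans (Gm-recurrence k (+ 0)) (trans (F≈ 0) (+-congˡ (u+β-*-coeff₀ q)))
         ; (suc n) → trans (Gm-recurrence k (+ suc n)) (trans (F≈ (suc n)) (trans (+-identityˡ _) (u+β-*-coeff q n)))
         })
      0

-- The variables are listed by a bijection z, so that their number is
-- visibly positive while the ring stays an opaque R⟦x⟧ d.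
module JacobiTrudi (d n : ℕ) (z : Fin (suc n) → Fin d)
  (reindex : ∀ {c ℓ} (R : CommutativeRing c ℓ) (t : Fin d → CommutativeRing.Carrier R) →
             CommutativeRing._≈_ R (RingNotation.product R t) (RingNotation.product R (t ∘ z))) where
  open MultiSeries ℤ[ Indeterminate ]
  open Limits ℤ[ Indeterminate ]
  open RingNotation (R⟦x⟧ d)
  open SetoidReasoning setoid
  open Solver commutativeSemiring using (solve; _:+_; _:*_; _:=_; con)
  open FactorialGrothendieck d using (x; β′; b′; F; F-coeff; [_∣b]^_; entry; Gm)
  open PowerSeries (R⟦x⟧ d) using (C; geometric; _≋_)
  open SeriesCoefficients (R⟦x⟧ d)
  open Determinant (R⟦x⟧ d)
  open LinearFactors (R⟦x⟧ d)
  open Cancellation (R⟦x⟧ d)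
  open Entries d
  open ConstantTerm d using (Gm-0)
  private
    module U = RingNotation (R⟦x⟧ d ⟦X⟧)
    module Σ = Sum semiring
    module Π = CommutativeMonoidSum *-commutativeMonoid
    module ΠU = CommutativeMonoidSum U.*-commutativeMonoid

  w : Fin d → Carrier
  w i = 1# + β′ * x i

  F-coeff≈extend : ∀ k m → F-coeff k m ≈ extend (F k) m
  F-coeff≈extend k (+ n)    = refl
  F-coeff≈extend k -[1+ n ] = refl

  module _ (p : Fin (suc n)) where

    y = x (z p)
    v = w (z p)

    roots : ℕ → Carrier
    roots = coeffs (λ i → - x (z (punchIn p i))) (λ _ → 1#)

    -- ∏_{i ≠ p} (S - xᵢ) applied to E^e, at index m. For e and m taken from a row of the first
    -- matrix it is an entry of the product with `nodal`; all e and m are kept because the descent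
    -- in e compares neighbouring indices.
    pairing : ℤ → ℕ → ℤ → Carrier
    pairing e k m = sum {suc n} λ j → entry e k (m ℤ.+ + toℕ j) * roots (toℕ j)

    pairing-Pascal : ∀ e k m → pairing (ℤ.suc e) k m ≈ pairing e k m + β′ * pairing e k (ℤ.suc m)
    pairing-Pascal e k m = begin
      pairing (ℤ.suc e) k m
        ≈⟨ Σ.sum-cong-≋ {suc n} (λ j → trans (*-congʳ (entry-Pascal e k (m ℤ.+ + toℕ j)))
             (trans (distribʳ (roots (toℕ j)) _ _) (+-cong (sym (*-identityˡ _))
               (trans (*-assoc β′ _ _) (*-congˡ {β′} (*-congʳ
                 (reflexive (≡.cong (entry e k) (≡.sym (ℤ.+-assoc (+ 1) m (+ toℕ j))))))))))) ⟩
      sum {suc n} (λ j → 1# * (entry e k (m ℤ.+ + toℕ j) * roots (toℕ j)) + β′ * (entry e k (ℤ.suc m ℤ.+ + toℕ j) * roots (toℕ j)))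
        ≈⟨ sum-linear {suc n} 1# β′ (λ j → entry e k (m ℤ.+ + toℕ j) * roots (toℕ j)) (λ j → entry e k (ℤ.suc m ℤ.+ + toℕ j) * roots (toℕ j)) ⟩
      1# * pairing e k m + β′ * pairing e k (ℤ.suc m)
        ≈⟨ +-congʳ (*-identityˡ _) ⟩
      pairing e k m + β′ * pairing e k (ℤ.suc m) ∎

    null-pairing : ∀ e k m → Null d (λ s → pairing e k (m ℤ.+ + s))
    null-pairing e k m = null-sum d {suc n} (λ j s → entry e k (m ℤ.+ + s ℤ.+ + toℕ j) * roots (toℕ j)) λ j →
      null-*ʳ d (roots (toℕ j)) (null-resp d
        (λ s → reflexive (≡.cong (entry e k) (swap m (+ toℕ j) (+ s))))
        (null-entry e k (m ℤ.+ + toℕ j)))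
      where
      swap : ∀ i j k → i ℤ.+ j ℤ.+ k ≡ i ℤ.+ k ℤ.+ j
      swap = ℤ.solve-∀

    factor : Fin d → U.Carrier
    factor i = C (w i) U.* geometric (x i)

    F-factors : ∀ k → let L = U.product {k} (λ j → linearFactor β′ (b′ (toℕ j))) in
                F k ≋ U.product (λ i → factor (z (punchIn p i))) U.* (L U.* factor (z p))
    F-factors k = U.trans {F k} {(f U.* P) U.* L} {P U.* (L U.* f)}
      (U.*-congʳ {L} {U.product factor} {f U.* P}
        (U.trans {U.product factor} {U.product (factor ∘ z)} {f U.* P}
          (reindex (R⟦x⟧ d ⟦X⟧) factor) (ΠU.sum-remove {n} {p} (factor ∘ z))))
      (U.trans {(f U.* P) U.* L} {(P U.* f) U.* L} {P U.* (L U.* f)}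
        (U.*-congʳ {L} {f U.* P} {P U.* f} (U.*-comm f P))
        (U.trans {(P U.* f) U.* L} {P U.* (f U.* L)} {P U.* (L U.* f)} (U.*-assoc P f L)
          (U.*-congˡ {P} {f U.* L} {L U.* f} (U.*-comm f L))))
      where
      L = U.product {k} (λ j → linearFactor β′ (b′ (toℕ j)))
      f = factor (z p)
      P = U.product (λ i → factor (z (punchIn p i)))

    -- The shifts cancel the n factors of the other variables and raise the index by n. The index t
    -- + k reached lies beyond the degree k of the b-factors, where the remaining series is
    -- geometric.
    pairing-1 : ∀ k m t → m ℤ.+ + n ≡ + (t ℕ.+ k) →
                pairing (+ 1) k m ≈ product w * ([ y ∣b]^ k * y ^ t)
    pairing-1 k m t eq = begin
      pairing (+ 1) k m
        ≈⟨ Σ.sum-cong-≋ {suc n} (λ j → *-congʳ {roots (toℕ j)} (trans (entry-1 k (m ℤ.+ + toℕ j))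
             (trans (F-coeff≈extend k (m ℤ.+ + toℕ j)) (extend-cong (F-factors k) (m ℤ.+ + toℕ j))))) ⟩
      sum {suc n} (λ j → extend (P U.* (L U.* f)) (m ℤ.+ + toℕ j) * roots (toℕ j))
        ≈⟨ sum-coeffs (λ i → - x (z (punchIn p i))) (λ _ → 1#) (λ s → extend (P U.* (L U.* f)) (m ℤ.+ + s)) ℕ.≤-refl ⟩
      shifts (λ i → - x (z (punchIn p i))) (λ _ → 1#) (λ s → extend (P U.* (L U.* f)) (m ℤ.+ + s))
        ≈⟨ shifts-geometric-product (λ i → w (z (punchIn p i))) (λ i → x (z (punchIn p i))) (L U.* f) m ⟩
      W * extend (L U.* f) (m ℤ.+ + n)
        ≡⟨ ≡.cong (λ i → W * extend (L U.* f) i) eq ⟩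
      W * (L U.* f) (t ℕ.+ k)
        ≈⟨ *-congˡ {W} (trans (linearFactors-coeff {k} β′ y (λ j → b′ (toℕ j)) f geometric-f t)
             (*-congˡ {[ y ∣b]^ k} (C-*-coeff v (geometric y) t))) ⟩
      W * ([ y ∣b]^ k * (v * y ^ t))
        ≈⟨ solve 4 (λ W Q v t → W :* (Q :* (v :* t)) := v :* W :* (Q :* t)) refl W ([ y ∣b]^ k) v (y ^ t) ⟩
      v * W * ([ y ∣b]^ k * y ^ t)
        ≈⟨ *-congʳ (trans (reindex (R⟦x⟧ d) w) (Π.sum-remove {n} {p} (w ∘ z))) ⟨
      product w * ([ y ∣b]^ k * y ^ t) ∎
      where
      L = U.product {k} (λ j → linearFactor β′ (b′ (toℕ j)))
      f = factor (z p)
      P = U.product (λ i → factor (z (punchIn p i)))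
      W = product (λ i → w (z (punchIn p i)))
      geometric-f : ∀ n → f (suc n) ≈ y * f n
      geometric-f n = begin
        f (suc n)          ≈⟨ C-*-coeff v (geometric y) (suc n) ⟩
        v * (y * y ^ n)    ≈⟨ solve 3 (λ v y t → v :* (y :* t) := y :* (v :* t)) refl v y (y ^ n) ⟩
        y * (v * y ^ n)    ≈⟨ *-congˡ {y} (C-*-coeff v (geometric y) n) ⟨
        y * f n            ∎

    -- Passing from r to r + 1 divides by 1 + β S on the left and by
    -- 1 + β y on the right; null sequences are determined by their image
    -- under 1 + β S.
    pairing-negative : ∀ k m → m ℤ.+ + n ≡ + k → ∀ r t →
      v ^ r * pairing (+ 1 ℤ.- + r) k (m ℤ.+ + t) ≈ product w * ([ y ∣b]^ k * y ^ t)
    pairing-negative k m eq zero t = trans (*-identityˡ _) (pairing-1 k (m ℤ.+ + t) t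
      (≡.trans (≡.trans (ℤ.+-assoc m (+ t) (+ n)) (≡.trans (≡.cong (λ j → m ℤ.+ j) (ℤ.+-comm (+ t) (+ n))) (≡.sym (ℤ.+-assoc m (+ n) (+ t)))))
        (≡.trans (≡.cong (ℤ._+ + t) eq) (ℤ.+-comm (+ k) (+ t)))))
    pairing-negative k m eq (suc r) = null-recurrence-unique d β′
      (null-*ˡ d (v ^ suc r) (null-pairing e k m))
      (null-*ˡ d (product w) (null-*ˡ d ([ y ∣b]^ k) (λ n → n , λ s le → order-mono d le (order-var^ d (z p) s))))
      λ t → begin
        v ^ suc r * pairing e k (m ℤ.+ + t) + β′ * (v ^ suc r * pairing e k (m ℤ.+ + suc t))
          ≈⟨ solve 4 (λ v b f g → v :* f :+ b :* (v :* g) := v :* (f :+ b :* g)) refl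
               (v ^ suc r) β′ (pairing e k (m ℤ.+ + t)) (pairing e k (m ℤ.+ + suc t)) ⟩
        v ^ suc r * (pairing e k (m ℤ.+ + t) + β′ * pairing e k (m ℤ.+ + suc t))
          ≈⟨ *-congˡ {v ^ suc r} (trans (+-congˡ (*-congˡ {β′} (reflexive (≡.cong (pairing e k) (i+sucj≡suc[i+j] m t)))))
               (trans (sym (pairing-Pascal e k (m ℤ.+ + t))) (reflexive (≡.cong (λ e → pairing e k (m ℤ.+ + t)) (suc-e (+ r)))))) ⟩
        v ^ suc r * pairing (+ 1 ℤ.- + r) k (m ℤ.+ + t)
          ≈⟨ trans (*-assoc v (v ^ r) _) (*-congˡ {v} (pairing-negative k m eq r t)) ⟩
        v * (product w * ([ y ∣b]^ k * y ^ t))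
          ≈⟨ solve 5 (λ b y w q t → (con 1 :+ b :* y) :* (w :* (q :* t)) := w :* (q :* t) :+ b :* (w :* (q :* (y :* t)))) refl
               β′ y (product w) ([ y ∣b]^ k) (y ^ t) ⟩
        product w * ([ y ∣b]^ k * y ^ t) + β′ * (product w * ([ y ∣b]^ k * y ^ suc t)) ∎
      where
      e = + 1 ℤ.- + suc r
      suc-e : ∀ i → + 1 ℤ.+ (+ 1 ℤ.- (+ 1 ℤ.+ i)) ≡ + 1 ℤ.- i
      suc-e = ℤ.solve-∀

  matrix₁ matrix₂ : (Fin (suc n) → ℕ) → Matrix (suc n) (suc n)
  matrix₁ l i j = entry (+ suc (toℕ i) ℤ.- + suc n) (l i ℕ.+ (suc n ∸ suc (toℕ i))) (+ l i ℤ.+ + toℕ j ℤ.- + toℕ i)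
  matrix₂ l i j = entry (+ toℕ i ℤ.- + toℕ j) (l i ℕ.+ (suc n ∸ suc (toℕ i))) (+ l i ℤ.+ + toℕ j ℤ.- + toℕ i)

  numerator : (Fin (suc n) → ℕ) → Matrix (suc n) (suc n)
  numerator l i j = [ x (z j) ∣b]^ (l i ℕ.+ (suc n ∸ suc (toℕ i))) * w (z j) ^ toℕ i

  -- Row i has exponent 1 - r with r = n + 1 - i. Of the n + 1 factors `w (z p)`, r are absorbed by
  -- `pairing-negative`, and the other i make up the power in `numerator`.
  matrix₁-nodal : ∀ l i p → w (z p) ^ suc n * (matrix₁ l ⊗ nodal (x ∘ z)) i p ≈ product (w ∘ z) * numerator l i p
  matrix₁-nodal l i p = begin
    v′ ^ suc n * (matrix₁ l ⊗ nodal (x ∘ z)) i p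
      ≈⟨ *-congˡ {v′ ^ suc n} (Σ.sum-cong-≋ {suc n} λ j → *-congʳ {roots p (toℕ j)} (reflexive (≡.cong₂ (λ e m → entry e k m) e≡ (m≡ j)))) ⟩
    v′ ^ suc n * pairing p (+ 1 ℤ.- + r) k (m ℤ.+ + 0)
      ≈⟨ *-congʳ (trans (reflexive (≡.cong (v′ ^_) (≡.sym (ℕ.m+[n∸m]≡n i≤suc-n)))) (Exp.^-homo-* semiring v′ (toℕ i) r)) ⟩
    v′ ^ toℕ i * v′ ^ r * pairing p (+ 1 ℤ.- + r) k (m ℤ.+ + 0)
      ≈⟨ trans (*-assoc _ _ _) (*-congˡ {v′ ^ toℕ i} (pairing-negative p k m m+n≡k r 0)) ⟩
    v′ ^ toℕ i * (product w * ([ x (z p) ∣b]^ k * 1#))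
      ≈⟨ solve 3 (λ v w q → v :* (w :* (q :* con 1)) := w :* (q :* v)) refl (v′ ^ toℕ i) (product w) ([ x (z p) ∣b]^ k) ⟩
    product w * numerator l i p
      ≈⟨ *-congʳ (reindex (R⟦x⟧ d) w) ⟩
    product (w ∘ z) * numerator l i p ∎
    where
    v′ = w (z p)
    k = l i ℕ.+ (suc n ∸ suc (toℕ i))
    m = + l i ℤ.- + toℕ i
    i≤n : toℕ i ≤ n
    i≤n = ℕ.≤-pred (Fin.toℕ<n i)
    i≤suc-n : toℕ i ≤ suc n
    i≤suc-n = ℕ.m≤n⇒m≤1+n i≤n
    r = suc n ∸ toℕ i
    e-lemma : ∀ i n → (+ 1 ℤ.+ i) ℤ.- n ≡ + 1 ℤ.- (n ℤ.- i)
    e-lemma = ℤ.solve-∀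
    e≡ : + suc (toℕ i) ℤ.- + suc n ≡ + 1 ℤ.- + r
    e≡ = ≡.trans (e-lemma (+ toℕ i) (+ suc n)) (≡.cong (λ j → + 1 ℤ.- j) (≡.sym (pos-∸ i≤suc-n)))
    m-lemma : ∀ l j i → l ℤ.+ j ℤ.- i ≡ l ℤ.- i ℤ.+ + 0 ℤ.+ j
    m-lemma = ℤ.solve-∀
    m≡ : ∀ (j : Fin (suc n)) → + l i ℤ.+ + toℕ j ℤ.- + toℕ i ≡ m ℤ.+ + 0 ℤ.+ + toℕ j
    m≡ j = m-lemma (+ l i) (+ toℕ j) (+ toℕ i)
    k-lemma : ∀ l i n → l ℤ.- i ℤ.+ n ≡ l ℤ.+ (n ℤ.- i)
    k-lemma = ℤ.solve-∀
    -- The n shifts lead exactly to index k, so t = 0 and no further power of the variable appears.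
    m+n≡k : m ℤ.+ + n ≡ + k
    m+n≡k = ≡.trans (k-lemma (+ l i) (+ toℕ i) (+ n)) (≡.cong (λ j → + l i ℤ.+ j) (≡.sym (pos-∸ i≤n)))

  vandermonde-det-matrix₁ : ∀ l → vandermondeProduct (x ∘ z) * det (matrix₁ l) ≈ det (numerator l)
  vandermonde-det-matrix₁ l = bialternant (x ∘ z) (w ∘ z)
    (λ p → cancellable-1+ d (order-*ˡ d β′ (order-var d (z p))))
    (matrix₁ l) (numerator l) (matrix₁-nodal l)

  -- In column j the exponent rises from i - n to i - j. The increase n - j is the same in all rows,
  -- so column operations achieve it.
  det-matrix₁≈det-matrix₂ : ∀ l → det (matrix₁ l) ≈ det (matrix₂ l)
  det-matrix₁≈det-matrix₂ l = begin
    det (matrix₁ l)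
      ≈⟨ det-cong (λ i j → reflexive (≡.cong₂ (λ e m → entry e (k i) m) (≡.sym (ℤ.+-identityʳ (e i))) (m≡ i (toℕ j)))) ⟩
    det (λ i j → a i 0 (toℕ j))
      ≈⟨ det-column-operations a (λ i r s → trans
           (reflexive (≡.cong (λ e → entry e (k i) (m i ℤ.+ + s)) (i+sucj≡suc[i+j] (e i) r)))
           (trans (entry-Pascal (e i ℤ.+ + r) (k i) (m i ℤ.+ + s))
             (+-congˡ (*-congˡ {β′} (reflexive (≡.cong (entry (e i ℤ.+ + r) (k i)) (≡.sym (i+sucj≡suc[i+j] (m i) s)))))))) ⟩
    det (λ i j → a i (suc n ∸ suc (toℕ j)) (toℕ j))
      ≈⟨ det-cong (λ i j → reflexive (≡.cong₂ (λ e m → entry e (k i) m) (e≡ i j) (≡.sym (m≡ i (toℕ j))))) ⟩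
    det (matrix₂ l) ∎
    where
    open ColumnOperations β′
    e : Fin (suc n) → ℤ
    e i = + suc (toℕ i) ℤ.- + suc n
    k : Fin (suc n) → ℕ
    k i = l i ℕ.+ (suc n ∸ suc (toℕ i))
    m : Fin (suc n) → ℤ
    m i = + l i ℤ.- + toℕ i
    a : Fin (suc n) → ℕ → ℕ → Carrier
    a i r s = entry (e i ℤ.+ + r) (k i) (m i ℤ.+ + s)
    m-lemma : ∀ l j i → l ℤ.+ j ℤ.- i ≡ l ℤ.- i ℤ.+ j
    m-lemma = ℤ.solve-∀
    m≡ : ∀ i j → + l i ℤ.+ + j ℤ.- + toℕ i ≡ m i ℤ.+ + j
    m≡ i j = m-lemma (+ l i) (+ j) (+ toℕ i)
    e-lemma : ∀ i n j → (+ 1 ℤ.+ i) ℤ.- (+ 1 ℤ.+ n) ℤ.+ (n ℤ.- j) ≡ i ℤ.- j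
    e-lemma = ℤ.solve-∀
    e≡ : ∀ i (j : Fin (suc n)) → e i ℤ.+ + (n ∸ toℕ j) ≡ + toℕ i ℤ.- + toℕ j
    e≡ i j = ≡.trans (≡.cong (λ k → e i ℤ.+ k) (pos-∸ (ℕ.≤-pred (Fin.toℕ<n j)))) (e-lemma (+ toℕ i) (+ n) (+ toℕ j))

  -- With i = j + 1 + r the exponent is r + 1 and the index -(r + 1), the boundary case t = 0 of
  -- `entry-vanishes`.
  subdiagonal : ∀ k {i j} → j < i → entry (+ i ℤ.- + j) k (+ 0 ℤ.+ + j ℤ.- + i) ≈ 0#
  subdiagonal k {i} {j} j<i with r , ≡.refl ← ℕ.m≤n⇒∃[o]m+o≡n j<i = trans
    (reflexive (≡.cong₂ (λ e m → entry e k m) (e-lemma (+ j) (+ r)) (m-lemma (+ j) (+ r)))) (entry-vanishes r 0 k)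
    where
    e-lemma : ∀ j r → (+ 1 ℤ.+ (j ℤ.+ r)) ℤ.- j ≡ + 1 ℤ.+ r
    e-lemma = ℤ.solve-∀
    m-lemma : ∀ j r → + 0 ℤ.+ j ℤ.- (+ 1 ℤ.+ (j ℤ.+ r)) ≡ ℤ.- (+ 1 ℤ.+ (r ℤ.+ + 0))
    m-lemma = ℤ.solve-∀

  diagonal : ∀ k i → entry (+ i ℤ.- + i) k (+ 0 ℤ.+ + i ℤ.- + i) ≈ 1#
  diagonal k i = trans
    (reflexive (≡.cong₂ (λ e m → entry e k m) (ℤ.+-inverseʳ (+ i)) (ℤ.+-inverseʳ (+ i))))
    (trans (entry-0 k (+ 0)) (Gm-0 k))

  det-matrix₂-row : ∀ k → det (matrix₂ (part (row k))) ≈ Gm (k ℕ.+ suc n ∸ 1) (+ k)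
  det-matrix₂-row k = begin
    det A
      ≈⟨ det-upper-block A (λ i → subdiagonal (suc n ∸ suc (suc (toℕ i))) {suc (toℕ i)} {0} (s≤s z≤n)) ⟩
    A zero zero * det (λ i j → A (suc i) (suc j))
      ≈⟨ *-cong (trans (entry-0 (k ℕ.+ n) (+ k ℤ.+ + 0 ℤ.- + 0)) (reflexive (≡.cong₂ Gm k≡ m≡)))
           (det-upper-unitriangular (λ i j → A (suc i) (suc j))
             (λ i j j<i → subdiagonal (suc n ∸ suc (suc (toℕ i))) {suc (toℕ i)} {suc (toℕ j)} (s≤s j<i))
             (λ i → diagonal (suc n ∸ suc (suc (toℕ i))) (suc (toℕ i)))) ⟩
    Gm (k ℕ.+ suc n ∸ 1) (+ k) * 1#
      ≈⟨ *-identityʳ _ ⟩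
    Gm (k ℕ.+ suc n ∸ 1) (+ k) ∎
    where
    A = matrix₂ (part (row k))
    k≡ : k ℕ.+ n ≡ k ℕ.+ suc n ∸ 1
    k≡ = ≡.cong (_∸ 1) (≡.sym (ℕ.+-suc k n))
    m-lemma : ∀ k → k ℤ.+ + 0 ℤ.- + 0 ≡ k
    m-lemma = ℤ.solve-∀
    m≡ : + k ℤ.+ + 0 ℤ.- + 0 ≡ + k
    m≡ = m-lemma (+ k)

-- Uniqueness of the quotient by the Vandermonde product.

module Quotient (d : ℕ) where
  open MultiSeries ℤ[ Indeterminate ] using (R⟦x⟧)
  open Limits ℤ[ Indeterminate ]
  open RingNotation (R⟦x⟧ d)
  open Cancellation (R⟦x⟧ d)
  open FactorialGrothendieck d using (x; vandermonde; IsG)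

  vandermonde-cancellable : Cancellable vandermonde
  vandermonde-cancellable = cancellable-product {d} (λ j → product {toℕ j} λ i → x (inject {i = j} i) - x j) λ j →
    cancellable-product {toℕ j} (λ i → x (inject {i = j} i) - x j) λ i →
      cancellable λ f → var-difference-regular d (≡.subst (_< toℕ j) (≡.sym (Fin.toℕ-inject {i = j} i)) (Fin.toℕ<n i)) f

  IsG-unique : ∀ p {G H} → IsG p G → IsG p H → G ≈ H
  IsG-unique p isG isH = vandermonde-cancellable (trans isG (sym isH))

  IsG-resp : ∀ p {G H} → G ≈ H → IsG p G → IsG p H
  IsG-resp p eq isG = trans (*-congˡ {vandermonde} (sym eq)) isG

open import Data.Nat.Base using (_+_)
open import Data.Product.Base using (_×_)

theorem1p1 : (d : ℕ) → .{{_ : NonZero d}} →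
    let open FactorialGrothendieck d in
    ((p : Partition d) →
    (∃[ G ] IsG p G) ×
    (∀ G → IsG p G →
    (G ≈ det (λ i j → entry (+ suc (toℕ i) ℤ.- + d)
    (part p i + (d ∸ suc (toℕ i)))
    (+ part p i ℤ.+ + toℕ j ℤ.- + toℕ i))) ×
    (G ≈ det (λ i j → entry (+ toℕ i ℤ.- + toℕ j)
    (part p i + (d ∸ suc (toℕ i)))
    (+ part p i ℤ.+ + toℕ j ℤ.- + toℕ i))))) ×
    ((k : ℕ) → ∀ G → IsG (row k) G → G ≈ Gm (k + d ∸ 1) (+ k))
theorem1p1 zero = ⊥-elim (ℕ.≢-nonZero⁻¹ 0 ≡.refl)
theorem1p1 d@(suc n) =
  (λ p → (FactorialGrothendieck.det d (matrix₁ (part p)) , isG₁ p) , λ G isG →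
     IsG-unique p {G} isG (isG₁ p) , IsG-unique p {G} isG (isG₂ p)) ,
  λ k G isG → IsG-unique (row k) {G} {FactorialGrothendieck.Gm d (k + d ∸ 1) (+ k)} isG
    (IsG-resp (row k) (det-matrix₂-row k) (isG₂ (row k)))
  where
  open FactorialGrothendieck d using (IsG)
  -- Since d is `suc n`, the identity serves as the listing of the variables and reindexing is
  -- reflexivity.
  open JacobiTrudi d n (λ i → i) (λ R t → CommutativeRing.refl R)
  open Quotient d
  isG₁ : ∀ p → IsG p (FactorialGrothendieck.det d (matrix₁ (part p)))
  isG₁ p = vandermonde-det-matrix₁ (part p)
  isG₂ : ∀ p → IsG p (FactorialGrothendieck.det d (matrix₂ (part p)))
  isG₂ p = IsG-resp p (det-matrix₁≈det-matrix₂ (part p)) (isG₁ p)
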